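{- Let $D_n=\sum_{k=0}^n\binom{n}{k}^2\binom{2k}{k}\binom{2(n-k)}{n-k}$ for $n\ge 0$. Then \[ \sum_{n\ge 1}\frac{64^n}{n^3D_nD_{n-1}}=\frac{56}{3}\zeta(3). \]
   Context: $\zeta$ denotes the Riemann zeta function. The numbers $D_n$ are called the Domb numbers. -}

module Defs where

open import Data.Nat.Base as ℕ using (ℕ; zero; suc; NonZero; NonTrivial; _∸_; _^_; _!; pred; s≤s; z≤n)
import Data.Nat.Properties as ℕ
open import Data.Nat.Properties using (_!≢0; _!*_!≢0)
open import Data.Nat.Combinatorics using (_C_; nCk≡n!/k![n-k]!; k![n∸k]!∣n!)
open import Data.Nat.DivMod using (m≥n⇒m/n>0)
open import Data.Nat.Divisibility using (∣⇒≤)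
open import Data.Integer.Base as ℤ using (ℤ; +_; +[1+_])
import Data.Integer.Properties as ℤ
open import Data.List.Base using (map; upTo)
open import Data.Nat.ListAction using (sum)
open import Data.Product.Base using (∃-syntax; _,_; proj₁; proj₂)
open import Data.Rational.Base as ℚ using (ℚ; 0ℚ; 1ℚ; ½; mkℚ; *<*)
  renaming (∣_∣ to ∣_∣ℚ; _/_ to _/ℚ_)
import Data.Rational.Properties as ℚ
open import Data.Rational.Solver using (module +-*-Solver)
open import Data.Rational.Unnormalised.Base as ℚᵘ using (mkℚᵘ)
import Data.Rational.Unnormalised.Properties as ℚᵘ
open import Data.Sum.Base using (inj₁; inj₂)
open import Relation.Binary.PropositionalEquality

IsCauchy : (ℕ → ℚ) → Set
IsCauchy x = ∀ ε → ε ℚ.> 0ℚ →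
  ∃[ N ] (∀ m n → m ℕ.≥ N → n ℕ.≥ N → ∣ x m ℚ.- x n ∣ℚ ℚ.< ε)

-- A real number is represented by any Cauchy sequence of rationals; no
-- quotient is taken, and _≤_ does not depend on the representatives.
record ℝ : Set where
  constructor mkℝ
  field
    seq    : ℕ → ℚ
    cauchy : IsCauchy seq
open ℝ public

infix 4 _≤_

_≤_ : ℝ → ℝ → Set
x ≤ y = ∀ ε → ε ℚ.> 0ℚ → ∃[ N ] (∀ n → n ℕ.≥ N → seq x n ℚ.≤ seq y n ℚ.+ ε)

half-pos : ∀ ε → ε ℚ.> 0ℚ → ½ ℚ.* ε ℚ.> 0ℚ
half-pos ε ε>0 = subst (ℚ._< ½ ℚ.* ε) (ℚ.*-zeroʳ ½) (ℚ.*-monoʳ-<-pos ½ ε>0)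

half+half : ∀ ε → ½ ℚ.* ε ℚ.+ ½ ℚ.* ε ≡ ε
half+half ε = trans (sym (ℚ.*-distribʳ-+ ε ½ ½)) (ℚ.*-identityˡ ε)

∣∣≤ : ∀ p {c} → p ℚ.≤ c → ℚ.- p ℚ.≤ c → ∣ p ∣ℚ ℚ.≤ c
∣∣≤ p p≤c -p≤c with ℚ.∣p∣≡p∨∣p∣≡-p p
... | inj₁ eq = ℚ.≤-trans (ℚ.≤-reflexive eq) p≤c
... | inj₂ eq = ℚ.≤-trans (ℚ.≤-reflexive eq) -p≤c

p≤∣p∣ : ∀ p → p ℚ.≤ ∣ p ∣ℚ
p≤∣p∣ p with ℚ.≤-total 0ℚ p
... | inj₁ 0≤p = ℚ.≤-reflexive (sym (ℚ.0≤p⇒∣p∣≡p 0≤p))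
... | inj₂ p≤0 = ℚ.≤-trans p≤0 (ℚ.0≤∣p∣ p)

neg-sub : ∀ p q → ℚ.- (p ℚ.- q) ≡ q ℚ.- p
neg-sub = solve 2 (λ p q → :- (p :- q) := q :- p) refl where open +-*-Solver

∣p∣-∣q∣≤∣p-q∣ : ∀ p q → ∣ p ∣ℚ ℚ.- ∣ q ∣ℚ ℚ.≤ ∣ p ℚ.- q ∣ℚ
∣p∣-∣q∣≤∣p-q∣ p q = begin
  ∣ p ∣ℚ ℚ.- ∣ q ∣ℚ                       ≡⟨ cong (λ r → ∣ r ∣ℚ ℚ.- ∣ q ∣ℚ) (eq₁ p q) ⟩
  ∣ (p ℚ.- q) ℚ.+ q ∣ℚ ℚ.- ∣ q ∣ℚ         ≤⟨ ℚ.+-monoˡ-≤ (ℚ.- ∣ q ∣ℚ) (ℚ.∣p+q∣≤∣p∣+∣q∣ (p ℚ.- q) q) ⟩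
  ∣ p ℚ.- q ∣ℚ ℚ.+ ∣ q ∣ℚ ℚ.- ∣ q ∣ℚ      ≡⟨ eq₂ ∣ p ℚ.- q ∣ℚ ∣ q ∣ℚ ⟩
  ∣ p ℚ.- q ∣ℚ                            ∎
  where
  open ℚ.≤-Reasoning
  open +-*-Solver
  eq₁ : ∀ p q → p ≡ (p ℚ.- q) ℚ.+ q
  eq₁ = solve 2 (λ p q → p := (p :- q) :+ q) refl
  eq₂ : ∀ p q → p ℚ.+ q ℚ.- q ≡ p
  eq₂ = solve 2 (λ p q → p :+ q :- q := p) refl

∣∣p∣-∣q∣∣≤∣p-q∣ : ∀ p q → ∣ ∣ p ∣ℚ ℚ.- ∣ q ∣ℚ ∣ℚ ℚ.≤ ∣ p ℚ.- q ∣ℚ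
∣∣p∣-∣q∣∣≤∣p-q∣ p q = ∣∣≤ (∣ p ∣ℚ ℚ.- ∣ q ∣ℚ) (∣p∣-∣q∣≤∣p-q∣ p q) (begin
  ℚ.- (∣ p ∣ℚ ℚ.- ∣ q ∣ℚ)  ≡⟨ neg-sub ∣ p ∣ℚ ∣ q ∣ℚ ⟩
  ∣ q ∣ℚ ℚ.- ∣ p ∣ℚ        ≤⟨ ∣p∣-∣q∣≤∣p-q∣ q p ⟩
  ∣ q ℚ.- p ∣ℚ             ≡⟨ cong ∣_∣ℚ (neg-sub p q) ⟨
  ∣ ℚ.- (p ℚ.- q) ∣ℚ       ≡⟨ ℚ.∣-p∣≡∣p∣ (p ℚ.- q) ⟩
  ∣ p ℚ.- q ∣ℚ             ∎)
  where open ℚ.≤-Reasoning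

fromℚ : ℚ → ℝ
fromℚ q = mkℝ (λ _ → q) λ ε ε>0 → 0 , λ _ _ _ _ →
  subst (λ r → ∣ r ∣ℚ ℚ.< ε) (sym (ℚ.+-inverseʳ q)) ε>0

infixl 6 _-_

_-_ : ℝ → ℝ → ℝ
x - y = mkℝ (λ n → seq x n ℚ.- seq y n) λ ε ε>0 →
  let N₁ , h₁ = cauchy x (½ ℚ.* ε) (half-pos ε ε>0)
      N₂ , h₂ = cauchy y (½ ℚ.* ε) (half-pos ε ε>0)
  in N₁ ℕ.⊔ N₂ , λ m n m≥ n≥ →
    let a = seq x m ; b = seq x n ; c = seq y m ; d = seq y n in begin-strict
    ∣ (a ℚ.- c) ℚ.- (b ℚ.- d) ∣ℚ         ≡⟨ cong ∣_∣ℚ (rearrange a b c d) ⟩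
    ∣ (a ℚ.- b) ℚ.- (c ℚ.- d) ∣ℚ         ≤⟨ ℚ.∣p-q∣≤∣p∣+∣q∣ (a ℚ.- b) (c ℚ.- d) ⟩
    ∣ a ℚ.- b ∣ℚ ℚ.+ ∣ c ℚ.- d ∣ℚ        <⟨ ℚ.+-mono-<
      (h₁ m n (ℕ.m⊔n≤o⇒m≤o N₁ N₂ m≥) (ℕ.m⊔n≤o⇒m≤o N₁ N₂ n≥))
      (h₂ m n (ℕ.m⊔n≤o⇒n≤o N₁ N₂ m≥) (ℕ.m⊔n≤o⇒n≤o N₁ N₂ n≥)) ⟩
    ½ ℚ.* ε ℚ.+ ½ ℚ.* ε                  ≡⟨ half+half ε ⟩
    ε                                    ∎
  where
  open ℚ.≤-Reasoning
  rearrange : ∀ a b c d → (a ℚ.- c) ℚ.- (b ℚ.- d) ≡ (a ℚ.- b) ℚ.- (c ℚ.- d)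
  rearrange = solve 4 (λ a b c d → (a :- c) :- (b :- d) := (a :- b) :- (c :- d)) refl
    where open +-*-Solver

∣_∣ : ℝ → ℝ
∣ x ∣ = mkℝ (λ n → ∣ seq x n ∣ℚ) λ ε ε>0 →
  let N , h = cauchy x ε ε>0
  in N , λ m n m≥ n≥ → ℚ.≤-<-trans (∣∣p∣-∣q∣∣≤∣p-q∣ (seq x m) (seq x n)) (h m n m≥ n≥)

infixl 7 _·_

_·_ : ℚ → ℝ → ℝ
q · x = mkℝ (λ n → q ℚ.* seq x n) λ ε ε>0 →
  let instance
        _ = c-pos
        _ = ℚ.pos⇒nonZero c
        _ = ℚ.1/pos⇒pos c
      δ   = ℚ.1/ c ℚ.* ε
      δ>0 = subst (ℚ._< δ) (ℚ.*-zeroʳ (ℚ.1/ c)) (ℚ.*-monoʳ-<-pos (ℚ.1/ c) ε>0)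
      N , h = cauchy x δ δ>0
  in N , λ m n m≥ n≥ → let d = seq x m ℚ.- seq x n in begin-strict
    ∣ q ℚ.* seq x m ℚ.- q ℚ.* seq x n ∣ℚ  ≡⟨ cong ∣_∣ℚ (factor q (seq x m) (seq x n)) ⟩
    ∣ q ℚ.* d ∣ℚ                          ≡⟨ ℚ.∣p*q∣≡∣p∣*∣q∣ q d ⟩
    ∣ q ∣ℚ ℚ.* ∣ d ∣ℚ                     ≤⟨ ℚ.*-monoʳ-≤-nonNeg ∣ d ∣ℚ {{ℚ.∣-∣-nonNeg d}} ∣q∣≤c ⟩
    c ℚ.* ∣ d ∣ℚ                          <⟨ ℚ.*-monoʳ-<-pos c (h m n m≥ n≥) ⟩
    c ℚ.* (ℚ.1/ c ℚ.* ε)                  ≡⟨ ℚ.*-assoc c (ℚ.1/ c) ε ⟨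
    c ℚ.* ℚ.1/ c ℚ.* ε                    ≡⟨ cong (ℚ._* ε) (ℚ.*-inverseʳ c) ⟩
    1ℚ ℚ.* ε                              ≡⟨ ℚ.*-identityˡ ε ⟩
    ε                                     ∎
  where
  open ℚ.≤-Reasoning
  c = ∣ q ∣ℚ ℚ.+ 1ℚ
  c-pos : ℚ.Positive c
  c-pos = ℚ.nonNeg+pos⇒pos ∣ q ∣ℚ {{ℚ.∣-∣-nonNeg q}} 1ℚ
  ∣q∣≤c : ∣ q ∣ℚ ℚ.≤ c
  ∣q∣≤c = subst (ℚ._≤ c) (ℚ.+-identityʳ ∣ q ∣ℚ) (ℚ.+-monoʳ-≤ ∣ q ∣ℚ (ℚ.nonNegative⁻¹ 1ℚ))
  factor : ∀ q a b → q ℚ.* a ℚ.- q ℚ.* b ≡ q ℚ.* (a ℚ.- b)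
  factor = solve 3 (λ q a b → q :* a :- q :* b := q :* (a :- b)) refl
    where open +-*-Solver

_ConvergesTo_ : (ℕ → ℝ) → ℝ → Set
x ConvergesTo l = ∀ ε → ε ℚ.> 0ℚ → ∃[ N ] (∀ n → n ℕ.≥ N → ∣ x n - l ∣ ≤ fromℚ ε)

-- Series are indexed by n ≥ 1: ∑ a N = a 1 + ⋯ + a N.
∑ : ((n : ℕ) → .{{NonZero n}} → ℚ) → ℕ → ℚ
∑ a zero    = 0ℚ
∑ a (suc N) = ∑ a N ℚ.+ a (suc N)

-- Convergence of the series is part of the claim.
HasSum : ((n : ℕ) → .{{NonZero n}} → ℚ) → ℝ → Set
HasSum a l = (λ N → fromℚ (∑ a N)) ConvergesTo l

ζ-term : ℕ → (n : ℕ) → .{{NonZero n}} → ℚ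
ζ-term s n = (+ 1 /ℚ n ^ s) {{ℕ.m^n≢0 n s}}

toℚᵘ-/ : ∀ i n .{{_ : NonZero n}} → ℚ.toℚᵘ (i /ℚ n) ℚᵘ.≃ i ℚᵘ./ n
toℚᵘ-/ i (suc n) = ℚ.toℚᵘ-fromℚᵘ (mkℚᵘ i n)

1/-anti : ∀ m n .{{_ : NonZero m}} .{{_ : NonZero n}} → m ℕ.≤ n → + 1 /ℚ n ℚ.≤ + 1 /ℚ m
1/-anti m@(suc _) n@(suc _) m≤n = ℚ.toℚᵘ-cancel-≤ (begin
  ℚ.toℚᵘ (+ 1 /ℚ n)  ≃⟨ toℚᵘ-/ (+ 1) n ⟩
  + 1 ℚᵘ./ n         ≤⟨ ℚᵘ.*≤* (ℤ.*-monoˡ-≤-nonNeg (+ 1) (ℤ.+≤+ m≤n)) ⟩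
  + 1 ℚᵘ./ m         ≃⟨ toℚᵘ-/ (+ 1) m ⟨
  ℚ.toℚᵘ (+ 1 /ℚ m)  ∎)
  where open ℚᵘ.≤-Reasoning

telescope : ∀ n .{{_ : NonZero n}} →
  (+ 1 /ℚ (n ℕ.* suc n)) {{ℕ.m*n≢0 n (suc n)}} ℚ.+ + 1 /ℚ suc n ≡ + 1 /ℚ n
telescope n@(suc k) = ℚ.toℚᵘ-injective (begin
  ℚ.toℚᵘ (p ℚ.+ q)                            ≈⟨ ℚ.toℚᵘ-homo-+ p q ⟩
  ℚ.toℚᵘ p ℚᵘ.+ ℚ.toℚᵘ q                      ≈⟨ ℚᵘ.+-cong (toℚᵘ-/ (+ 1) (n ℕ.* suc n)) (toℚᵘ-/ (+ 1) (suc n)) ⟩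
  + 1 ℚᵘ./ (n ℕ.* suc n) ℚᵘ.+ + 1 ℚᵘ./ suc n  ≈⟨ ℚᵘ.*≡* (cong +_ identity) ⟩
  + 1 ℚᵘ./ n                                  ≈⟨ toℚᵘ-/ (+ 1) n ⟨
  ℚ.toℚᵘ (+ 1 /ℚ n)                           ∎)
  where
  open import Relation.Binary.Reasoning.Setoid ℚᵘ.≃-setoid
  open import Data.Nat.Solver renaming (module +-*-Solver to ℕ-Solver)
  open ℕ-Solver
  p = + 1 /ℚ (n ℕ.* suc n)
  q = + 1 /ℚ suc n
  identity : (1 ℕ.* suc n ℕ.+ 1 ℕ.* (n ℕ.* suc n)) ℕ.* n ≡ 1 ℕ.* ((n ℕ.* suc n) ℕ.* suc n)
  identity = solve 1 (λ k → let n = con 1 :+ k ; m = con 1 :+ n in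
    (con 1 :* m :+ con 1 :* (n :* m)) :* n := con 1 :* ((n :* m) :* m)) refl k

archimedean : ∀ ε → ε ℚ.> 0ℚ → ∃[ N ] (+ 1 /ℚ suc N ℚ.< ε)
archimedean ε@(mkℚ (+ zero) _ _)     (*<* (ℤ.+<+ ()))
archimedean ε@(mkℚ (ℤ.-[1+ _ ]) _ _) (*<* ())
archimedean ε@(mkℚ +[1+ n ] d _) ε>0 = suc d , ℚ.toℚᵘ-cancel-< (begin-strict
  ℚ.toℚᵘ (+ 1 /ℚ suc (suc d))  ≃⟨ toℚᵘ-/ (+ 1) (suc (suc d)) ⟩
  + 1 ℚᵘ./ suc (suc d)         <⟨ ℚᵘ.*<* (ℤ.+<+ bound) ⟩
  ℚ.toℚᵘ ε                     ∎)
  where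
  open ℚᵘ.≤-Reasoning
  bound : 1 ℕ.* suc d ℕ.< suc n ℕ.* suc (suc d)
  bound = ℕ.≤-trans (s≤s (ℕ.≤-reflexive (ℕ.*-identityˡ (suc d)))) (ℕ.m≤m+n (suc (suc d)) (n ℕ.* suc (suc d)))

module _ (s : ℕ) .{{_ : NonTrivial s}} where
  private
    S = ∑ (ζ-term s)

    term-bound : ∀ n .{{_ : NonZero n}} → ζ-term s (suc n) ℚ.+ + 1 /ℚ suc n ℚ.≤ + 1 /ℚ n
    term-bound n@(suc k) = ℚ.≤-trans
      (ℚ.+-monoˡ-≤ (+ 1 /ℚ suc n) (1/-anti (n ℕ.* suc n) (suc n ^ s) {{_}} {{ℕ.m^n≢0 (suc n) s}} (begin
        n ℕ.* suc n      ≤⟨ ℕ.*-monoˡ-≤ (suc n) (ℕ.n≤1+n n) ⟩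
        suc n ℕ.* suc n  ≡⟨ cong (suc n ℕ.*_) (ℕ.*-identityʳ (suc n)) ⟨
        suc n ^ 2        ≤⟨ ℕ.^-monoʳ-≤ (suc n) (ℕ.nonTrivial⇒n>1 s) ⟩
        suc n ^ s        ∎)))
      (ℚ.≤-reflexive (telescope n))
      where open ℕ.≤-Reasoning

    lower : ∀ N k → S N ℚ.≤ S (k ℕ.+ N)
    lower N zero    = ℚ.≤-refl
    lower N (suc k) = ℚ.≤-trans (lower N k) (subst (ℚ._≤ S (suc k ℕ.+ N)) (ℚ.+-identityʳ (S (k ℕ.+ N)))
      (ℚ.+-monoʳ-≤ (S (k ℕ.+ N)) (ℚ.nonNegative⁻¹ t {{ℚ.normalize-nonNeg 1 (suc (k ℕ.+ N) ^ s) {{nz}}}})))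
      where
      nz = ℕ.m^n≢0 (suc (k ℕ.+ N)) s
      t  = ζ-term s (suc (k ℕ.+ N))

    upper : ∀ N k → S (k ℕ.+ suc N) ℚ.+ (+ 1 /ℚ (k ℕ.+ suc N)) {{ℕ.≢-nonZero (ℕ.m+1+n≢0 k)}}
                    ℚ.≤ S (suc N) ℚ.+ + 1 /ℚ suc N
    upper N zero    = ℚ.≤-refl
    upper N (suc k) = begin
      S M ℚ.+ ζ-term s (suc M) ℚ.+ + 1 /ℚ suc M    ≡⟨ ℚ.+-assoc (S M) (ζ-term s (suc M)) (+ 1 /ℚ suc M) ⟩
      S M ℚ.+ (ζ-term s (suc M) ℚ.+ + 1 /ℚ suc M)  ≤⟨ ℚ.+-monoʳ-≤ (S M) (term-bound M) ⟩
      S M ℚ.+ + 1 /ℚ M                             ≤⟨ upper N k ⟩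
      S (suc N) ℚ.+ + 1 /ℚ suc N                   ∎
      where
      open ℚ.≤-Reasoning
      M = k ℕ.+ suc N
      instance _ = ℕ.≢-nonZero (ℕ.m+1+n≢0 k {N})

    below : ∀ N n → suc N ℕ.≤ n → S (suc N) ℚ.≤ S n
    below N n N<n = subst (λ i → S (suc N) ℚ.≤ S i) (ℕ.m∸n+n≡m N<n) (lower (suc N) (n ∸ suc N))

    above : ∀ N n → suc N ℕ.≤ n → S n ℚ.≤ S (suc N) ℚ.+ + 1 /ℚ suc N
    above N n N<n = subst (λ i → S i ℚ.≤ S (suc N) ℚ.+ + 1 /ℚ suc N) (ℕ.m∸n+n≡m N<n)
      (ℚ.≤-trans (subst (ℚ._≤ S M ℚ.+ + 1 /ℚ M) (ℚ.+-identityʳ (S M))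
        (ℚ.+-monoʳ-≤ (S M) (ℚ.nonNegative⁻¹ (+ 1 /ℚ M) {{ℚ.normalize-nonNeg 1 M}}))) (upper N k))
      where
      k = n ∸ suc N
      M = k ℕ.+ suc N
      instance _ = ℕ.≢-nonZero (ℕ.m+1+n≢0 k {N})

    diff : ∀ N m n → suc N ℕ.≤ m → suc N ℕ.≤ n → S m ℚ.- S n ℚ.≤ + 1 /ℚ suc N
    diff N m n N<m N<n = begin
      S m ℚ.- S n                                    ≤⟨ ℚ.+-mono-≤ (above N m N<m) (ℚ.neg-antimono-≤ (below N n N<n)) ⟩
      S (suc N) ℚ.+ + 1 /ℚ suc N ℚ.- S (suc N)       ≡⟨ cancel (S (suc N)) (+ 1 /ℚ suc N) ⟩
      + 1 /ℚ suc N                                   ∎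
      where
      open ℚ.≤-Reasoning
      open +-*-Solver
      cancel : ∀ a b → a ℚ.+ b ℚ.- a ≡ b
      cancel = solve 2 (λ a b → a :+ b :- a := b) refl

  ζ-cauchy : IsCauchy (∑ (ζ-term s))
  ζ-cauchy ε ε>0 = let N , 1/N<ε = archimedean ε ε>0 in
    suc N , λ m n m≥ n≥ → ℚ.≤-<-trans
      (∣∣≤ (S m ℚ.- S n) (diff N m n m≥ n≥)
        (subst (ℚ._≤ + 1 /ℚ suc N) (sym (neg-sub (S m) (S n))) (diff N n m n≥ m≥)))
      1/N<ε

  -- The Riemann zeta function at integers s ≥ 2 (NonTrivial s), by its
  -- Dirichlet series.
  ζ : ℝ
  ζ = mkℝ (∑ (ζ-term s)) ζ-cauchy

domb-summand : ℕ → ℕ → ℕ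
domb-summand n k = (n C k) ^ 2 ℕ.* ((2 ℕ.* k) C k) ℕ.* ((2 ℕ.* (n ∸ k)) C (n ∸ k))

-- The Domb numbers.
D : ℕ → ℕ
D n = sum (map (domb-summand n) (upTo (suc n)))

C≢0 : ∀ {n k} → k ℕ.≤ n → NonZero (n C k)
C≢0 {n} {k} k≤n = ℕ.>-nonZero (subst (ℕ._> 0) (sym (nCk≡n!/k![n-k]! k≤n))
  (m≥n⇒m/n>0 {{k !* (n ∸ k) !≢0}} (∣⇒≤ {{n !≢0}} (k![n∸k]!∣n! k≤n))))

D≢0 : ∀ n → NonZero (D n)
D≢0 n = ℕ.>-nonZero (ℕ.≤-trans (ℕ.>-nonZero⁻¹ (domb-summand n 0) {{summand≢0}}) (ℕ.m≤m+n (domb-summand n 0) _))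
  where
  summand≢0 : NonZero (domb-summand n 0)
  summand≢0 = ℕ.m*n≢0 ((n C 0) ^ 2 ℕ.* (0 C 0)) ((2 ℕ.* n) C n)
    {{ℕ.m*n≢0 ((n C 0) ^ 2) (0 C 0) {{ℕ.m^n≢0 (n C 0) 2 {{C≢0 {n} {0} z≤n}}}} {{C≢0 {0} {0} z≤n}}}}
    {{C≢0 (ℕ.m≤m+n n _)}}

-- 64ⁿ / (n³ Dₙ Dₙ₋₁); pred is n - 1, as n ≥ 1.
domb-term : (n : ℕ) → .{{NonZero n}} → ℚ
domb-term n = (+ (64 ^ n) /ℚ (n ^ 3 ℕ.* D n ℕ.* D (pred n)))
  {{ℕ.m*n≢0 (n ^ 3 ℕ.* D n) (D (pred n))
    {{ℕ.m*n≢0 (n ^ 3) (D n) {{ℕ.m^n≢0 n 3}} {{D≢0 n}}}} {{D≢0 (pred n)}}}}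

{-# OPTIONS --safe #-}
module Submission where

-- Put u a = (2a)!/a!⁴, so that Dₙ/n!² is the sum of u a * u b over a + b = n. From
-- a³ u(a) = 2(2a-1) u(a-1) and an expansion of (a+b)⁵ one gets the recurrence of Dₙ.
-- The same computation at the half-integers a = n+ν+½, b = -(ν+½) shows that
--   σₙ = n!² 4ⁿ Σ_{ν≥0} (ν+1)⋯(ν+n) / ((ν+½)⋯(ν+n+½))³
-- satisfies the same recurrence, with σ₀ = Σ 1/(ν+½)³ = 7ζ(3) and σ₁ = 4σ₀ - 24.
-- The Casoratian of two solutions is explicit, so σₙ/Dₙ is 7ζ(3) minus 3/8 of the
-- n-th partial sum of the series; and σₙ/Dₙ → 0, since σₙ ≤ 4ⁿ σ₀ and 64 Dₙ ≥ 8ⁿ.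
-- All sums over ν are truncated at M, with errors O(1/M).

open import Defs hiding (_≤_; _-_; ∣_∣)
open import Data.Integer.Base as ℤ using (+_)
import Data.Integer.Properties as ℤ
open import Data.List.Base using (applyUpTo)
open import Data.List.Properties using (map-upTo)
open import Data.Nat.Base as ℕ using (ℕ; zero; suc; NonZero; nonTrivial; _!)
open import Data.Nat.Combinatorics using (_C_; nCk≡n!/k![n-k]!; k![n∸k]!∣n!)
open import Data.Nat.DivMod using (m/n*n≡m)
open import Data.Nat.ListAction using (sum)
import Data.Nat.Properties as ℕ
open import Data.Product.Base using (∃-syntax; _,_)
open import Data.Rational.Base hiding (NonZero)
open import Data.Rational.Literals using (fromℤ)
open import Data.Rational.Properties
import Data.Rational.Unnormalised.Base as ℚᵘ
import Data.Rational.Unnormalised.Properties as ℚᵘ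
open import Relation.Binary.PropositionalEquality
open import Relation.Nullary.Decidable.Core using (dec⇒maybe)
open import Tactic.RingSolver using (solve-∀)
open import Tactic.RingSolver.Core.AlmostCommutativeRing using (AlmostCommutativeRing; fromCommutativeRing)

-- Dividing the Domb recurrence by n³ and letting n grow gives x² - 20x + 64, with roots 4 and 16.
-- Dₙ belongs to the root 16; what is needed is a second solution belonging to 4, so that σₙ/Dₙ
-- tends to 0. Half-integers supply one: the factor 2(2a-1) that lowers u vanishes at a = ½, so a
-- sum along a + b = n over half-integral b < 0 can start at b = -½ without a boundary term, just as
-- the integer convolution ends where a³ or b³ vanishes. Towards ν = ∞ nothing cuts the sum off, and
-- the boundary terms there have to be estimated. The real number σₙ itself never occurs. Reals
-- being Cauchy sequences of rationals, all identities are between rationals at a fixed M, and the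
-- same M indexes the sequence of ζ(3). The constants in O(1/M) depend on n with no uniformity. This
-- is harmless, since convergence asks for a bound ε on the partial sum at n and only then, with n
-- fixed, for an index M: only the bound on σₙ/Dₙ must be uniform in M.

ring : AlmostCommutativeRing _ _
ring = fromCommutativeRing +-*-commutativeRing (λ x → dec⇒maybe (0ℚ ≟ x))

interchange : ∀ a b c d → a + b + (c + d) ≡ a + c + (b + d)
interchange = solve-∀ ring

infix 9 #_

#_ : ℕ → ℚ
# n = fromℤ (+ n)

-- Casts of variables are opaque, so that arithmetic on them does not unfold
-- to the normalisation of fractions; literals (#_) compute, for the ring solver.
opaque
  ι : ℕ → ℚ
  ι n = # n

  ι≡# : ∀ n → ι n ≡ # n
  ι≡# n = refl

  ι-+ : ∀ m n → ι (m ℕ.+ n) ≡ ι m + ι n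
  ι-+ m n = toℚᵘ-injective (ℚᵘ.≃-trans
    (ℚᵘ.*≡* (cong (ℤ._* + 1) (sym (cong₂ ℤ._+_ (ℤ.*-identityʳ (+ m)) (ℤ.*-identityʳ (+ n))))))
    (ℚᵘ.≃-sym (toℚᵘ-homo-+ (ι m) (ι n))))

  ι-* : ∀ m n → ι (m ℕ.* n) ≡ ι m * ι n
  ι-* m n = toℚᵘ-injective (ℚᵘ.≃-trans
    (ℚᵘ.*≡* (cong (ℤ._* + 1) (ℤ.pos-* m n)))
    (ℚᵘ.≃-sym (toℚᵘ-homo-* (ι m) (ι n))))

  ι-/ : ∀ m n .{{_ : NonZero n}} → ι n * (+ m / n) ≡ ι m
  ι-/ m n@(suc _) = toℚᵘ-injective (begin
    toℚᵘ (ι n * (+ m / n))          ≈⟨ toℚᵘ-homo-* (ι n) (+ m / n) ⟩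
    toℚᵘ (ι n) ℚᵘ.* toℚᵘ (+ m / n)  ≈⟨ ℚᵘ.*-congˡ {toℚᵘ (ι n)} (toℚᵘ-/ (+ m) n) ⟩
    toℚᵘ (ι n) ℚᵘ.* (+ m ℚᵘ./ n)    ≈⟨ ℚᵘ.*≡* (trans (ℤ.*-identityʳ (+ n ℤ.* + m))
                                         (trans (ℤ.*-comm (+ n) (+ m)) (cong (λ k → + m ℤ.* + k) (sym (ℕ.*-identityˡ n))))) ⟩
    toℚᵘ (ι m)                      ∎)
    where open import Relation.Binary.Reasoning.Setoid ℚᵘ.≃-setoid

ι-suc : ∀ n → ι (suc n) ≡ ι n + 1ℚ
ι-suc n = trans (ι-+ 1 n) (trans (cong (_+ ι n) (ι≡# 1)) (+-comm 1ℚ (ι n)))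

open ≤-Reasoning

-- Sums over a + b = n

conv : (ℕ → ℕ → ℚ) → ℕ → ℚ
conv F zero    = F 0 0
conv F (suc n) = F 0 (suc n) + conv (λ a b → F (suc a) b) n

-- The recursion of `conv` exposes only the end a = 0; lowering b requires splitting off the end b =
-- 0 as well.
conv-last : ∀ F n → conv F (suc n) ≡ conv (λ a b → F a (suc b)) n + F (suc n) 0
conv-last F zero    = refl
conv-last F (suc n) = trans (cong (_+_ (F 0 (suc (suc n)))) (conv-last (λ a b → F (suc a) b) n))
  (sym (+-assoc (F 0 (suc (suc n))) (conv (λ a b → F (suc a) (suc b)) n) (F (suc (suc n)) 0)))

conv-cong : ∀ {F G} n → (∀ a b → a ℕ.+ b ≡ n → F a b ≡ G a b) → conv F n ≡ conv G n
conv-cong zero    F≗G = F≗G 0 0 refl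
conv-cong (suc n) F≗G = cong₂ _+_ (F≗G 0 (suc n) refl) (conv-cong n λ a b a+b≡n → F≗G (suc a) b (cong suc a+b≡n))

conv-+ : ∀ F G n → conv (λ a b → F a b + G a b) n ≡ conv F n + conv G n
conv-+ F G zero    = refl
conv-+ F G (suc n) = trans (cong (_+_ (F 0 (suc n) + G 0 (suc n))) (conv-+ (λ a b → F (suc a) b) (λ a b → G (suc a) b) n))
  (interchange (F 0 (suc n)) (G 0 (suc n)) _ _)

conv-* : ∀ c F n → conv (λ a b → c * F a b) n ≡ c * conv F n
conv-* c F zero    = refl
conv-* c F (suc n) = trans (cong (_+_ (c * F 0 (suc n))) (conv-* c (λ a b → F (suc a) b) n))
  (sym (*-distribˡ-+ c (F 0 (suc n)) (conv (λ a b → F (suc a) b) n)))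

-- `F` takes both indices, so that the induction can shift the first one while `suc n ∸ suc k`
-- reduces to `n ∸ k`.
ι-sum-applyUpTo : ∀ (F : ℕ → ℕ → ℕ) n →
  ι (sum (applyUpTo (λ k → F k (n ℕ.∸ k)) (suc n))) ≡ conv (λ a b → ι (F a b)) n
ι-sum-applyUpTo F zero    = cong ι (ℕ.+-identityʳ (F 0 0))
ι-sum-applyUpTo F (suc n) = trans (ι-+ (F 0 (suc n)) _) (cong (_+_ (ι (F 0 (suc n)))) (ι-sum-applyUpTo (λ a b → F (suc a) b) n))

-- Domb numbers as a convolution, and their recurrence

-- The Domb recurrence is (n+1)³ Dₙ₊₁ = P(n) Dₙ - 64 n³ Dₙ₋₁.
P : ℚ → ℚ
P x = # 20 * (x * x * x) + # 30 * (x * x) + # 18 * x + # 4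

1/! : ℕ → ℚ
1/! k = (+ 1 / k !) {{k ℕ.!≢0}}

u : ℕ → ℚ
u k = ι ((2 ℕ.* k) !) * (1/! k * 1/! k * (1/! k * 1/! k))

!*1/! : ∀ k → ι (k !) * 1/! k ≡ 1ℚ
!*1/! k = trans (ι-/ 1 (k !) {{k ℕ.!≢0}}) (ι≡# 1)

1/!-suc : ∀ k → 1/! k ≡ ι (suc k) * 1/! (suc k)
1/!-suc k = begin-equality
  1/! k                                      ≡⟨ *-identityʳ (1/! k) ⟨
  1/! k * 1ℚ                                 ≡⟨ cong (1/! k *_) (!*1/! (suc k)) ⟨
  1/! k * (ι (suc k !) * 1/! (suc k))        ≡⟨ cong (λ x → 1/! k * (x * 1/! (suc k))) (ι-* (suc k) (k !)) ⟩
  1/! k * (ι (suc k) * ι (k !) * 1/! (suc k))  ≡⟨ rearrange (1/! k) (ι (suc k)) (ι (k !)) (1/! (suc k)) ⟩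
  ι (k !) * 1/! k * (ι (suc k) * 1/! (suc k))  ≡⟨ cong (_* (ι (suc k) * 1/! (suc k))) (!*1/! k) ⟩
  1ℚ * (ι (suc k) * 1/! (suc k))             ≡⟨ *-identityˡ _ ⟩
  ι (suc k) * 1/! (suc k)                    ∎
  where
  rearrange : ∀ r k f s → r * (k * f * s) ≡ f * r * (k * s)
  rearrange = solve-∀ ring

-- Passing from k! to (k+1)! in the denominator costs a⁴, but (2k+2)! = 2a (2k+1) (2k)! returns one
-- factor a, so a³ suffices.
u-suc : ∀ k → let a = ι (suc k) in a * a * a * u (suc k) ≡ (# 4 * ι k + # 2) * u k
u-suc k = begin-equality
  a * a * a * (ι ((2 ℕ.* suc k) !) * (s * s * (s * s)))
    ≡⟨ cong (λ x → a * a * a * (x * (s * s * (s * s)))) fact ⟩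
  a * a * a * (# 2 * a * ((# 2 * ι k + 1ℚ) * f) * (s * s * (s * s)))
    ≡⟨ rearrange a (ι k) f s ⟩
  (# 4 * ι k + # 2) * (f * (a * s * (a * s) * (a * s * (a * s))))
    ≡⟨ cong (λ r → (# 4 * ι k + # 2) * (f * (r * r * (r * r)))) (1/!-suc k) ⟨
  (# 4 * ι k + # 2) * u k ∎
  where
  a = ι (suc k)
  s = 1/! (suc k)
  f = ι ((2 ℕ.* k) !)
  rearrange : ∀ a k f s → a * a * a * (# 2 * a * ((# 2 * k + 1ℚ) * f) * (s * s * (s * s))) ≡
    (# 4 * k + # 2) * (f * (a * s * (a * s) * (a * s * (a * s))))
  rearrange = solve-∀ ring
  ι2* : ∀ m → ι (2 ℕ.* m) ≡ # 2 * ι m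
  ι2* m = trans (ι-* 2 m) (cong (_* ι m) (ι≡# 2))
  fact : ι ((2 ℕ.* suc k) !) ≡ # 2 * a * ((# 2 * ι k + 1ℚ) * f)
  fact = begin-equality
    ι ((2 ℕ.* suc k) !)                                ≡⟨ cong (λ m → ι (m !)) (ℕ.*-suc 2 k) ⟩
    ι (suc (suc (2 ℕ.* k)) !)                          ≡⟨ ι-* (suc (suc (2 ℕ.* k))) (suc (2 ℕ.* k) !) ⟩
    ι (2 ℕ.+ 2 ℕ.* k) * ι (suc (2 ℕ.* k) !)            ≡⟨ cong₂ _*_ (trans (cong ι (sym (ℕ.*-suc 2 k))) (ι2* (suc k)))
                                                           (trans (ι-* (suc (2 ℕ.* k)) ((2 ℕ.* k) !))
                                                             (cong (_* f) (trans (ι-suc (2 ℕ.* k)) (cong (_+ 1ℚ) (ι2* k))))) ⟩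
    # 2 * a * ((# 2 * ι k + 1ℚ) * f)                   ∎

nCk*k!*[n∸k]! : ∀ {n k} → k ℕ.≤ n → (n C k) ℕ.* (k ! ℕ.* (n ℕ.∸ k) !) ≡ n !
nCk*k!*[n∸k]! {n} {k} k≤n = trans (cong (ℕ._* (k ! ℕ.* (n ℕ.∸ k) !)) (nCk≡n!/k![n-k]! k≤n))
  (m/n*n≡m {{k ℕ.!* (n ℕ.∸ k) !≢0}} (k![n∸k]!∣n! k≤n))

ι-nCk : ∀ a b → ι ((a ℕ.+ b) !) ≡ ι ((a ℕ.+ b) C a) * (ι (a !) * ι (b !))
ι-nCk a b = begin-equality
  ι ((a ℕ.+ b) !)                            ≡⟨ cong ι (nCk*k!*[n∸k]! (ℕ.m≤m+n a b)) ⟨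
  ι (c ℕ.* (a ! ℕ.* (a ℕ.+ b ℕ.∸ a) !))      ≡⟨ cong (λ x → ι (c ℕ.* (a ! ℕ.* x !))) (ℕ.m+n∸m≡n a b) ⟩
  ι (c ℕ.* (a ! ℕ.* b !))                    ≡⟨ trans (ι-* c (a ! ℕ.* b !)) (cong (ι c *_) (ι-* (a !) (b !))) ⟩
  ι c * (ι (a !) * ι (b !))                  ∎
  where c = (a ℕ.+ b) C a

ι-2kCk : ∀ k → ι ((2 ℕ.* k) !) ≡ ι ((2 ℕ.* k) C k) * (ι (k !) * ι (k !))
ι-2kCk k = subst (λ m → ι (m !) ≡ ι (m C k) * (ι (k !) * ι (k !))) (cong (k ℕ.+_) (sym (ℕ.+-identityʳ k))) (ι-nCk k k)

E : ℕ → ℚ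
E = conv λ a b → u a * u b

φ : ℕ → ℚ
φ n = ι (n !) * ι (n !)

φ-suc : ∀ n → φ (suc n) ≡ ι (suc n) * ι (suc n) * φ n
φ-suc n = trans (cong (λ x → x * x) (ι-* (suc n) (n !))) (rearrange (ι (suc n)) (ι (n !)))
  where
  rearrange : ∀ m f → m * f * (m * f) ≡ m * m * (f * f)
  rearrange = solve-∀ ring

domb-summand-u : ∀ a b → let n = a ℕ.+ b in
  ι ((n C a) ℕ.^ 2 ℕ.* ((2 ℕ.* a) C a) ℕ.* ((2 ℕ.* b) C b)) ≡ φ n * (u a * u b)
domb-summand-u a b = begin-equality
  ι (c ℕ.^ 2 ℕ.* p ℕ.* q)
    ≡⟨ trans (ι-* (c ℕ.^ 2 ℕ.* p) q) (cong (_* ι q) (trans (ι-* (c ℕ.^ 2) p) (cong (_* ι p) (trans (cong (λ x → ι (c ℕ.* x)) (ℕ.*-identityʳ c)) (ι-* c c))))) ⟩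
  ι c * ι c * ι p * ι q
    ≡⟨ cancel (ι c) (ι p) (ι q) (ι (a !)) (ι (b !)) (1/! a) (1/! b) (!*1/! a) (!*1/! b) ⟨
  _ ≡⟨ cong₂ (λ x y → x * x * y) (ι-nCk a b) (cong₂ (λ x y → x * (1/! a * 1/! a * (1/! a * 1/! a)) * (y * (1/! b * 1/! b * (1/! b * 1/! b)))) (ι-2kCk a) (ι-2kCk b)) ⟨
  φ (a ℕ.+ b) * (u a * u b) ∎
  where
  c = (a ℕ.+ b) C a
  p = (2 ℕ.* a) C a
  q = (2 ℕ.* b) C b
  rearrange : ∀ c p q A B r s →
    c * (A * B) * (c * (A * B)) * (p * (A * A) * (r * r * (r * r)) * (q * (B * B) * (s * s * (s * s)))) ≡
    c * c * p * q * ((A * r) * (A * r) * ((A * r) * (A * r)) * ((B * s) * (B * s) * ((B * s) * (B * s))))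
  rearrange = solve-∀ ring
  cancel : ∀ c p q A B r s → A * r ≡ 1ℚ → B * s ≡ 1ℚ →
    c * (A * B) * (c * (A * B)) * (p * (A * A) * (r * r * (r * r)) * (q * (B * B) * (s * s * (s * s)))) ≡ c * c * p * q
  cancel c p q A B r s Ar≡1 Bs≡1 = trans (rearrange c p q A B r s)
    (trans (cong₂ (λ x y → c * c * p * q * (x * x * (x * x) * (y * y * (y * y)))) Ar≡1 Bs≡1) (*-identityʳ (c * c * p * q)))

ι-D : ∀ n → ι (D n) ≡ φ n * E n
ι-D n = begin-equality
  ι (D n)                                        ≡⟨ cong (λ l → ι (sum l)) (map-upTo (domb-summand n) (suc n)) ⟩
  ι (sum (applyUpTo (domb-summand n) (suc n)))   ≡⟨ ι-sum-applyUpTo (λ a b → (n C a) ℕ.^ 2 ℕ.* ((2 ℕ.* a) C a) ℕ.* ((2 ℕ.* b) C b)) n ⟩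
  conv (λ a b → ι ((n C a) ℕ.^ 2 ℕ.* ((2 ℕ.* a) C a) ℕ.* ((2 ℕ.* b) C b))) n
                                                 ≡⟨ conv-cong n (λ { a b refl → domb-summand-u a b }) ⟩
  conv (λ a b → φ n * (u a * u b)) n             ≡⟨ conv-* (φ n) (λ a b → u a * u b) n ⟩
  φ n * E n                                      ∎

-- The factor a³ lowers a and kills the term a = 0; likewise b³ for b. Both halves land on the same
-- pairs with a + b = n, where the two weights add up to the constant (4a+2) + (4b+2) = 4(n+1).
conv-cubes : ∀ n → conv (λ a b → (ι a * ι a * ι a + ι b * ι b * ι b) * (u a * u b)) (suc n) ≡ # 4 * ι (suc n) * E n
conv-cubes n = begin-equality
  conv (λ a b → (ι a * ι a * ι a + ι b * ι b * ι b) * (u a * u b)) (suc n)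
    ≡⟨ conv-cong (suc n) (λ a b _ → *-distribʳ-+ (u a * u b) (ι a * ι a * ι a) (ι b * ι b * ι b)) ⟩
  conv (λ a b → X a b + Y a b) (suc n)
    ≡⟨ conv-+ X Y (suc n) ⟩
  (X 0 (suc n) + conv (λ a b → X (suc a) b) n) + conv Y (suc n)
    ≡⟨ cong₂ _+_ (trans (cong (_+ conv (λ a b → X (suc a) b) n) (vanish (u 0 * u (suc n)))) (+-identityˡ (conv (λ a b → X (suc a) b) n)))
                 (trans (conv-last Y n) (trans (cong (_+_ (conv (λ a b → Y a (suc b)) n)) (vanish (u (suc n) * u 0))) (+-identityʳ _))) ⟩
  conv (λ a b → X (suc a) b) n + conv (λ a b → Y a (suc b)) n
    ≡⟨ conv-+ (λ a b → X (suc a) b) (λ a b → Y a (suc b)) n ⟨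
  conv (λ a b → X (suc a) b + Y a (suc b)) n
    ≡⟨ conv-cong n pointwise ⟩
  conv (λ a b → # 4 * ι (suc n) * (u a * u b)) n
    ≡⟨ conv-* (# 4 * ι (suc n)) (λ a b → u a * u b) n ⟩
  # 4 * ι (suc n) * E n ∎
  where
  X Y : ℕ → ℕ → ℚ
  X a b = ι a * ι a * ι a * (u a * u b)
  Y a b = ι b * ι b * ι b * (u a * u b)
  vanish : ∀ x → ι 0 * ι 0 * ι 0 * x ≡ 0ℚ
  vanish x = trans (cong (λ z → z * z * z * x) (ι≡# 0)) (*-zeroˡ x)
  identity : ∀ a b s t x y x′ y′ → s * s * s * x′ ≡ (# 4 * a + # 2) * x → t * t * t * y′ ≡ (# 4 * b + # 2) * y →
    s * s * s * (x′ * y) + t * t * t * (x * y′) ≡ # 4 * (a + b + 1ℚ) * (x * y)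
  identity a b s t x y x′ y′ p q = begin-equality
    s * s * s * (x′ * y) + t * t * t * (x * y′)                ≡⟨ rearrange₁ (s * s * s) x′ y (t * t * t) x y′ ⟩
    s * s * s * x′ * y + t * t * t * y′ * x                    ≡⟨ cong₂ (λ v w → v * y + w * x) p q ⟩
    (# 4 * a + # 2) * x * y + (# 4 * b + # 2) * y * x          ≡⟨ rearrange₂ a b x y ⟩
    # 4 * (a + b + 1ℚ) * (x * y)                               ∎
    where
    rearrange₁ : ∀ s x′ y t x y′ → s * (x′ * y) + t * (x * y′) ≡ s * x′ * y + t * y′ * x
    rearrange₁ = solve-∀ ring
    rearrange₂ : ∀ a b x y → (# 4 * a + # 2) * x * y + (# 4 * b + # 2) * y * x ≡ # 4 * (a + b + 1ℚ) * (x * y)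
    rearrange₂ = solve-∀ ring
  pointwise : ∀ a b → a ℕ.+ b ≡ n → X (suc a) b + Y a (suc b) ≡ # 4 * ι (suc n) * (u a * u b)
  pointwise a b refl = trans
    (identity (ι a) (ι b) (ι (suc a)) (ι (suc b)) (u a) (u b) (u (suc a)) (u (suc b)) (u-suc a) (u-suc b))
    (cong (λ x → # 4 * x * (u a * u b)) (trans (cong (_+ 1ℚ) (sym (ι-+ a b))) (sym (ι-suc (a ℕ.+ b)))))

-- In (a+b)⁵ every monomial is divisible by a³ or by b³, so u-suc lowers each to
-- level n; there the result is P(a+b) - 16 (a³+b³), and conv-cubes lowers the cubes.
E-rec : ∀ n → let N = ι (suc n) in
  N * N * N * N * N * E (suc n) ≡ P (ι n) * E n + - # 16 * conv (λ a b → (ι a * ι a * ι a + ι b * ι b * ι b) * (u a * u b)) n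
E-rec n = begin-equality
  N * N * N * N * N * E (suc n)
    ≡⟨ conv-* (N * N * N * N * N) (λ a b → u a * u b) (suc n) ⟨
  conv (λ a b → N * N * N * N * N * (u a * u b)) (suc n)
    ≡⟨ conv-cong (suc n) split ⟩
  conv (λ a b → X a b + Y a b) (suc n)
    ≡⟨ conv-+ X Y (suc n) ⟩
  (X 0 (suc n) + conv (λ a b → X (suc a) b) n) + conv Y (suc n)
    ≡⟨ cong₂ _+_
         (trans (cong (_+ conv (λ a b → X (suc a) b) n) (vanish (q (ι 0) (ι (suc n))) (u 0 * u (suc n)))) (+-identityˡ (conv (λ a b → X (suc a) b) n)))
         (trans (conv-last Y n) (trans (cong (_+_ (conv (λ a b → Y a (suc b)) n)) (vanish (q (ι 0) (ι (suc n))) (u (suc n) * u 0))) (+-identityʳ _))) ⟩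
  conv (λ a b → X (suc a) b) n + conv (λ a b → Y a (suc b)) n
    ≡⟨ conv-+ (λ a b → X (suc a) b) (λ a b → Y a (suc b)) n ⟨
  conv (λ a b → X (suc a) b + Y a (suc b)) n
    ≡⟨ conv-cong n pointwise ⟩
  conv (λ a b → P (ι n) * (u a * u b) + - # 16 * ((ι a * ι a * ι a + ι b * ι b * ι b) * (u a * u b))) n
    ≡⟨ conv-+ (λ a b → P (ι n) * (u a * u b)) (λ a b → - # 16 * ((ι a * ι a * ι a + ι b * ι b * ι b) * (u a * u b))) n ⟩
  conv (λ a b → P (ι n) * (u a * u b)) n + conv (λ a b → - # 16 * ((ι a * ι a * ι a + ι b * ι b * ι b) * (u a * u b))) n
    ≡⟨ cong₂ _+_ (conv-* (P (ι n)) (λ a b → u a * u b) n) (conv-* (- # 16) (λ a b → (ι a * ι a * ι a + ι b * ι b * ι b) * (u a * u b)) n) ⟩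
  P (ι n) * E n + - # 16 * conv (λ a b → (ι a * ι a * ι a + ι b * ι b * ι b) * (u a * u b)) n ∎
  where
  N = ι (suc n)
  q : ℚ → ℚ → ℚ
  q a b = a * a + # 5 * a * b + # 10 * b * b
  X Y : ℕ → ℕ → ℚ
  X a b = ι a * ι a * ι a * q (ι a) (ι b) * (u a * u b)
  Y a b = ι b * ι b * ι b * q (ι b) (ι a) * (u a * u b)
  vanish : ∀ x y → ι 0 * ι 0 * ι 0 * x * y ≡ 0ℚ
  vanish x y = trans (cong (λ z → z * z * z * x * y) (ι≡# 0)) (trans (cong (_* y) (*-zeroˡ x)) (*-zeroˡ y))
  split : ∀ a b → a ℕ.+ b ≡ suc n → N * N * N * N * N * (u a * u b) ≡ X a b + Y a b
  split a b a+b≡1+n = trans (cong (λ m → m * m * m * m * m * (u a * u b)) (trans (cong ι (sym a+b≡1+n)) (ι-+ a b)))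
    (binomial (ι a) (ι b) (u a * u b))
    where
    binomial : ∀ a b w → (a + b) * (a + b) * (a + b) * (a + b) * (a + b) * w ≡
      a * a * a * (a * a + # 5 * a * b + # 10 * b * b) * w + b * b * b * (b * b + # 5 * b * a + # 10 * a * a) * w
    binomial = solve-∀ ring
  identity : ∀ a b s t x y x′ y′ → s * s * s * x′ ≡ (# 4 * a + # 2) * x → t * t * t * y′ ≡ (# 4 * b + # 2) * y →
    s ≡ a + 1ℚ → t ≡ b + 1ℚ →
    s * s * s * q s b * (x′ * y) + t * t * t * q t a * (x * y′) ≡ P (a + b) * (x * y) + - # 16 * ((a * a * a + b * b * b) * (x * y))
  identity a b s t x y x′ y′ p r refl refl = begin-equality
    s * s * s * q s b * (x′ * y) + t * t * t * q t a * (x * y′)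
      ≡⟨ rearrange₁ (s * s * s) x′ y (t * t * t) x y′ (q s b) (q t a) ⟩
    q s b * (s * s * s * x′) * y + q t a * (t * t * t * y′) * x
      ≡⟨ cong₂ (λ v w → q s b * v * y + q t a * w * x) p r ⟩
    q s b * ((# 4 * a + # 2) * x) * y + q t a * ((# 4 * b + # 2) * y) * x
      ≡⟨ rearrange₂ a b x y ⟩
    P (a + b) * (x * y) + - # 16 * ((a * a * a + b * b * b) * (x * y)) ∎
    where
    rearrange₁ : ∀ s x′ y t x y′ q r → s * q * (x′ * y) + t * r * (x * y′) ≡ q * (s * x′) * y + r * (t * y′) * x
    rearrange₁ = solve-∀ ring
    rearrange₂ : ∀ a b x y →
      ((a + 1ℚ) * (a + 1ℚ) + # 5 * (a + 1ℚ) * b + # 10 * b * b) * ((# 4 * a + # 2) * x) * y +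
      ((b + 1ℚ) * (b + 1ℚ) + # 5 * (b + 1ℚ) * a + # 10 * a * a) * ((# 4 * b + # 2) * y) * x ≡
      (# 20 * ((a + b) * (a + b) * (a + b)) + # 30 * ((a + b) * (a + b)) + # 18 * (a + b) + # 4) * (x * y) +
      - # 16 * ((a * a * a + b * b * b) * (x * y))
    rearrange₂ = solve-∀ ring
  pointwise : ∀ a b → a ℕ.+ b ≡ n → X (suc a) b + Y a (suc b) ≡
    P (ι n) * (u a * u b) + - # 16 * ((ι a * ι a * ι a + ι b * ι b * ι b) * (u a * u b))
  pointwise a b refl = trans
    (identity (ι a) (ι b) (ι (suc a)) (ι (suc b)) (u a) (u b) (u (suc a)) (u (suc b)) (u-suc a) (u-suc b) (ι-suc a) (ι-suc b))
    (cong (λ x → P x * (u a * u b) + - # 16 * ((ι a * ι a * ι a + ι b * ι b * ι b) * (u a * u b))) (sym (ι-+ a b)))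

-- The factor φ n = n!² turns the recurrence of E into the Domb recurrence.
rescale : ∀ n x₀ x₁ x₂ g → let m = ι (suc n) ; N = ι (suc (suc n)) in
  N * N * N * N * N * x₂ ≡ P m * x₁ + - # 64 * m * x₀ + g →
  N * N * N * (φ (suc (suc n)) * x₂) ≡ P m * (φ (suc n) * x₁) + - # 64 * (m * m * m) * (φ n * x₀) + φ (suc n) * g
rescale n x₀ x₁ x₂ g rec = begin-equality
  N * N * N * (φ (suc (suc n)) * x₂)            ≡⟨ cong (λ f → N * N * N * (f * x₂)) (φ-suc (suc n)) ⟩
  N * N * N * (N * N * φ (suc n) * x₂)          ≡⟨ rearrange₁ N (φ (suc n)) x₂ ⟩
  φ (suc n) * (N * N * N * N * N * x₂)          ≡⟨ cong (φ (suc n) *_) rec ⟩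
  φ (suc n) * (P m * x₁ + - # 64 * m * x₀ + g)  ≡⟨ rearrange₂ (φ (suc n)) (P m) x₁ m x₀ g ⟩
  P m * (φ (suc n) * x₁) + - # 64 * m * (φ (suc n) * x₀) + φ (suc n) * g
    ≡⟨ cong (λ f → P m * (φ (suc n) * x₁) + - # 64 * m * (f * x₀) + φ (suc n) * g) (φ-suc n) ⟩
  P m * (φ (suc n) * x₁) + - # 64 * m * (m * m * φ n * x₀) + φ (suc n) * g
    ≡⟨ cong (λ z → P m * (φ (suc n) * x₁) + z + φ (suc n) * g) (rearrange₃ m (φ n) x₀) ⟩
  P m * (φ (suc n) * x₁) + - # 64 * (m * m * m) * (φ n * x₀) + φ (suc n) * g ∎
  where
  m = ι (suc n)
  N = ι (suc (suc n))
  rearrange₁ : ∀ N f x → N * N * N * (N * N * f * x) ≡ f * (N * N * N * N * N * x)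
  rearrange₁ = solve-∀ ring
  rearrange₂ : ∀ f p x m y g → f * (p * x + - # 64 * m * y + g) ≡ p * (f * x) + - # 64 * m * (f * y) + f * g
  rearrange₂ = solve-∀ ring
  rearrange₃ : ∀ m f y → - # 64 * m * (m * m * f * y) ≡ - # 64 * (m * m * m) * (f * y)
  rearrange₃ = solve-∀ ring

D-rec : ∀ n → let m = ι (suc n) ; N = ι (suc (suc n)) in
  N * N * N * ι (D (suc (suc n))) ≡ P m * ι (D (suc n)) + - # 64 * (m * m * m) * ι (D n)
D-rec n = begin-equality
  N * N * N * ι (D (suc (suc n)))
    ≡⟨ cong (N * N * N *_) (ι-D (suc (suc n))) ⟩
  N * N * N * (φ (suc (suc n)) * E (suc (suc n)))
    -- A finite convolution leaves no boundary term, hence `0ℚ`; for the sums truncated at M this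
    -- argument of `rescale` is their boundary term.
    ≡⟨ rescale n (E n) (E (suc n)) (E (suc (suc n))) 0ℚ E-rec′ ⟩
  P m * (φ (suc n) * E (suc n)) + - # 64 * (m * m * m) * (φ n * E n) + φ (suc n) * 0ℚ
    ≡⟨ trans (cong (_+_ (P m * (φ (suc n) * E (suc n)) + - # 64 * (m * m * m) * (φ n * E n))) (*-zeroʳ (φ (suc n)))) (+-identityʳ _) ⟩
  P m * (φ (suc n) * E (suc n)) + - # 64 * (m * m * m) * (φ n * E n)
    ≡⟨ cong₂ (λ x y → P m * x + - # 64 * (m * m * m) * y) (ι-D (suc n)) (ι-D n) ⟨
  P m * ι (D (suc n)) + - # 64 * (m * m * m) * ι (D n) ∎
  where
  m = ι (suc n)
  N = ι (suc (suc n))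
  E-rec′ : N * N * N * N * N * E (suc (suc n)) ≡ P m * E (suc n) + - # 64 * m * E n + 0ℚ
  E-rec′ = begin-equality
    N * N * N * N * N * E (suc (suc n))               ≡⟨ E-rec (suc n) ⟩
    P m * E (suc n) + - # 16 * conv (λ a b → (ι a * ι a * ι a + ι b * ι b * ι b) * (u a * u b)) (suc n)
                                                      ≡⟨ cong (λ z → P m * E (suc n) + - # 16 * z) (conv-cubes n) ⟩
    P m * E (suc n) + - # 16 * (# 4 * m * E n)        ≡⟨ rearr (P m * E (suc n)) m (E n) ⟩
    P m * E (suc n) + - # 64 * m * E n + 0ℚ           ∎
    where
    rearr : ∀ e m y → e + - # 16 * (# 4 * m * y) ≡ e + - # 64 * m * y + 0ℚ
    rearr = solve-∀ ring

-- Inequalities, and the half-integers with their reciprocals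

0≤* : ∀ {p q} → 0ℚ ≤ p → 0ℚ ≤ q → 0ℚ ≤ p * q
0≤* {p} {q} 0≤p 0≤q = subst (_≤ p * q) (*-zeroʳ p) (*-monoˡ-≤-nonNeg p {{nonNegative 0≤p}} 0≤q)

*-monoˡ : ∀ {r p q} → 0ℚ ≤ r → p ≤ q → r * p ≤ r * q
*-monoˡ {r} 0≤r = *-monoˡ-≤-nonNeg r {{nonNegative 0≤r}}

*-monoʳ : ∀ {r p q} → 0ℚ ≤ r → p ≤ q → p * r ≤ q * r
*-monoʳ {r} 0≤r = *-monoʳ-≤-nonNeg r {{nonNegative 0≤r}}

p≤p+q : ∀ p {q} → 0ℚ ≤ q → p ≤ p + q
p≤p+q p {q} 0≤q = subst (_≤ p + q) (+-identityʳ p) (+-monoʳ-≤ p 0≤q)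

0≤ι : ∀ n → 0ℚ ≤ ι n
0≤ι n = subst (0ℚ ≤_) (sym (ι≡# n)) (nonNegative⁻¹ (# n))

y : ℕ → ℚ
y k = ι k + ½

opaque
  -- The reciprocal of `y k`, as `y*i` confirms, written as 2/(2k+1) to have a natural denominator.
  i : ℕ → ℚ
  i k = + 2 / suc (2 ℕ.* k)

  0≤i : ∀ k → 0ℚ ≤ i k
  0≤i k = nonNegative⁻¹ (i k) {{normalize-nonNeg 2 (suc (2 ℕ.* k))}}

  [1+2k]*i : ∀ k → (# 2 * ι k + 1ℚ) * i k ≡ # 2
  [1+2k]*i k = begin-equality
    (# 2 * ι k + 1ℚ) * i k     ≡⟨ cong (λ x → (x * ι k + 1ℚ) * i k) (ι≡# 2) ⟨
    (ι 2 * ι k + 1ℚ) * i k     ≡⟨ cong (λ x → (x + 1ℚ) * i k) (ι-* 2 k) ⟨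
    (ι (2 ℕ.* k) + 1ℚ) * i k   ≡⟨ cong (_* i k) (ι-suc (2 ℕ.* k)) ⟨
    ι (suc (2 ℕ.* k)) * i k    ≡⟨ ι-/ 2 (suc (2 ℕ.* k)) ⟩
    ι 2                        ≡⟨ ι≡# 2 ⟩
    # 2                        ∎

y*i : ∀ k → y k * i k ≡ 1ℚ
y*i k = trans (halve (ι k) (i k)) (cong (½ *_) ([1+2k]*i k))
  where
  halve : ∀ k r → (k + ½) * r ≡ ½ * ((# 2 * k + 1ℚ) * r)
  halve = solve-∀ ring

0≤y : ∀ k → 0ℚ ≤ y k
0≤y k = ≤-trans (0≤ι k) (p≤p+q (ι k) (nonNegative⁻¹ ½))

ι*i≤1 : ∀ k → ι k * i k ≤ 1ℚ
ι*i≤1 k = subst (ι k * i k ≤_) (y*i k) (*-monoʳ (0≤i k) (p≤p+q (ι k) (nonNegative⁻¹ ½)))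

i≤2 : ∀ k → i k ≤ # 2
i≤2 k = subst (i k ≤_) (cong (# 2 *_) (y*i k))
  (subst (_≤ # 2 * (y k * i k)) (halves (i k)) (*-monoˡ {# 2} (nonNegative⁻¹ (# 2)) (*-monoʳ (0≤i k)
    (subst (_≤ y k) (+-identityˡ ½) (+-monoˡ-≤ ½ (0≤ι k))))))
  where
  halves : ∀ r → # 2 * (½ * r) ≡ r
  halves = solve-∀ ring

y-suc : ∀ k → y (suc k) ≡ y k + 1ℚ
y-suc k = trans (cong (_+ ½) (ι-suc k)) (swap (ι k))
  where
  swap : ∀ k → k + 1ℚ + ½ ≡ k + ½ + 1ℚ
  swap = solve-∀ ring

-- Since `y (suc k)` exceeds `y k` by 1, the difference of the reciprocals is their product.
i-anti : ∀ k → i (suc k) ≤ i k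
i-anti k = subst (i (suc k) ≤_) (sym eq) (p≤p+q (i (suc k)) (0≤* (0≤i k) (0≤i (suc k))))
  where
  expand : ∀ r s y → r * ((y + 1ℚ) * s) ≡ y * r * s + r * s
  expand = solve-∀ ring
  eq : i k ≡ i (suc k) + i k * i (suc k)
  eq = begin-equality
    i k                                        ≡⟨ *-identityʳ (i k) ⟨
    i k * 1ℚ                                   ≡⟨ cong (i k *_) (trans (cong (_* i (suc k)) (sym (y-suc k))) (y*i (suc k))) ⟨
    i k * ((y k + 1ℚ) * i (suc k))             ≡⟨ expand (i k) (i (suc k)) (y k) ⟩
    y k * i k * i (suc k) + i k * i (suc k)    ≡⟨ cong (λ x → x * i (suc k) + i k * i (suc k)) (y*i k) ⟩
    1ℚ * i (suc k) + i k * i (suc k)           ≡⟨ cong (_+ i k * i (suc k)) (*-identityˡ (i (suc k))) ⟩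
    i (suc k) + i k * i (suc k)                ∎

-- The summand at half-integers

-- f n ν replaces u a * u b at a = n+ν+½, b = -(ν+½): it satisfies the same
-- first-order recurrences in a and in b.
κ : ℕ → ℚ
κ k = # 4 * ι k * (i k * i k * i k)

f : ℕ → ℕ → ℚ
f zero    ν = i ν * i ν * i ν
f (suc n) ν = f n ν * κ (suc (n ℕ.+ ν))

cancel-y³ : ∀ k x → y k * y k * y k * (x * (i k * i k * i k)) ≡ x
cancel-y³ k x = trans (rearrange (y k) (i k) x) (trans (cong (λ z → z * z * z * x) (y*i k)) (*-identityˡ x))
  where
  rearrange : ∀ y r x → y * y * y * (x * (r * r * r)) ≡ y * r * (y * r) * (y * r) * x
  rearrange = solve-∀ ring

f-suc-cubed : ∀ n ν → let k = suc (n ℕ.+ ν) in y k * y k * y k * f (suc n) ν ≡ # 4 * ι k * f n ν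
f-suc-cubed n ν = trans (cong (y k * y k * y k *_) (rearrange (f n ν) (ι k) (i k * i k * i k))) (cancel-y³ k (# 4 * ι k * f n ν))
  where
  k = suc (n ℕ.+ ν)
  rearrange : ∀ f k r → f * (# 4 * k * r) ≡ # 4 * k * f * r
  rearrange = solve-∀ ring

-- Lowering b = -(ν+½) by 1 raises ν, and the signs of b³ and of 2(2b-1) cancel. In the induction
-- both sides gain the same factor `κ`, because (n+1) + ν = n + (ν+1).
f-suc-shift : ∀ n ν → y ν * y ν * y ν * f (suc n) ν ≡ # 4 * ι (suc ν) * f n (suc ν)
f-suc-shift zero ν = trans (cong (y ν * y ν * y ν *_) (*-comm (i ν * i ν * i ν) (κ (suc ν)))) (cancel-y³ ν (κ (suc ν)))
f-suc-shift (suc n) ν = begin-equality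
  y ν * y ν * y ν * (f (suc n) ν * κ (suc (suc n ℕ.+ ν)))   ≡⟨ *-assoc (y ν * y ν * y ν) (f (suc n) ν) (κ (suc (suc n ℕ.+ ν))) ⟨
  y ν * y ν * y ν * f (suc n) ν * κ (suc (suc n ℕ.+ ν))     ≡⟨ cong₂ (λ z k → z * κ (suc k)) (f-suc-shift n ν) (sym (ℕ.+-suc n ν)) ⟩
  # 4 * ι (suc ν) * f n (suc ν) * κ (suc (n ℕ.+ suc ν))     ≡⟨ *-assoc (# 4 * ι (suc ν)) (f n (suc ν)) (κ (suc (n ℕ.+ suc ν))) ⟩
  # 4 * ι (suc ν) * f (suc n) (suc ν)                       ∎

y-+ : ∀ n ν → y (n ℕ.+ ν) ≡ ι n + y ν
y-+ n ν = trans (cong (_+ ½) (ι-+ n ν)) (+-assoc (ι n) (ι ν) ½)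

-- In terms of a = n + c and b = -c: cubes is the summand (a³+b³) f, while B and C
-- are the parts telescoping in ν when (a+b)⁵ f and (a³+b³) f are lowered.
cubes B C : ℕ → ℕ → ℚ
cubes n ν = let a = ι n + y ν ; c = y ν in (a * a * a - c * c * c) * f n ν
B n ν = let a = ι n + y ν ; c = y ν in
  (# 4 * c - # 2) * (# 10 * a * a - # 5 * a * (c - 1ℚ) + (c - 1ℚ) * (c - 1ℚ)) * f n ν
C n ν = (# 4 * y ν - # 2) * f n ν

4ι-suc : ∀ k → # 4 * ι (suc k) ≡ # 4 * y k + # 2
4ι-suc k = trans (cong (# 4 *_) (ι-suc k)) (expand (ι k))
  where
  expand : ∀ k → # 4 * (k + 1ℚ) ≡ # 4 * (k + ½) + # 2
  expand = solve-∀ ring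

module _ (n ν : ℕ) where
  private
    m = ι n
    c = y ν
    a = m + c
    F = f n ν
    F′ = f n (suc ν)
    G = f (suc n) ν

  f-suc-y : (a + 1ℚ) * (a + 1ℚ) * (a + 1ℚ) * G ≡ (# 4 * a + # 2) * F
  f-suc-y = begin-equality
    (a + 1ℚ) * (a + 1ℚ) * (a + 1ℚ) * G
      ≡⟨ cong (λ z → z * z * z * G) (trans (cong (_+ 1ℚ) (sym (y-+ n ν))) (sym (y-suc (n ℕ.+ ν)))) ⟩
    y (suc (n ℕ.+ ν)) * y (suc (n ℕ.+ ν)) * y (suc (n ℕ.+ ν)) * G
      ≡⟨ f-suc-cubed n ν ⟩
    # 4 * ι (suc (n ℕ.+ ν)) * F
      ≡⟨ cong (_* F) (trans (4ι-suc (n ℕ.+ ν)) (cong (λ z → # 4 * z + # 2) (y-+ n ν))) ⟩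
    (# 4 * a + # 2) * F ∎

  f-suc-shift-y : c * c * c * G ≡ (# 4 * c + # 2) * F′
  f-suc-shift-y = trans (f-suc-shift n ν) (cong (_* F′) (4ι-suc ν))

  -- Unlike in `E-rec`, the part lowered in b sits at ν+1. Its weight is exactly that of
  -- `B n (suc ν)`, so adding and subtracting `B n ν` separates a telescoping difference from terms
  -- at ν.
  f-rec : let N = ι (suc n) in
    N * N * N * N * N * G ≡ P m * F + - # 16 * cubes n ν + (B n ν - B n (suc ν))
  f-rec = begin-equality
    N * N * N * N * N * G
      ≡⟨ cong (λ z → z * z * z * z * z * G) (ι-suc n) ⟩
    (m + 1ℚ) * (m + 1ℚ) * (m + 1ℚ) * (m + 1ℚ) * (m + 1ℚ) * G
      ≡⟨ binomial m c G ⟩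
    (A * A - # 5 * A * c + # 10 * c * c) * (A * A * A * G) - (# 10 * A * A - # 5 * A * c + c * c) * (c * c * c * G)
      ≡⟨ cong₂ (λ v w → (A * A - # 5 * A * c + # 10 * c * c) * v - (# 10 * A * A - # 5 * A * c + c * c) * w) f-suc-y f-suc-shift-y ⟩
    (A * A - # 5 * A * c + # 10 * c * c) * ((# 4 * a + # 2) * F) - (# 10 * A * A - # 5 * A * c + c * c) * ((# 4 * c + # 2) * F′)
      ≡⟨ collect m c F F′ ⟩
    P m * F + - # 16 * cubes n ν + (B n ν - β (c + 1ℚ) * F′)
      ≡⟨ cong (λ z → P m * F + - # 16 * cubes n ν + (B n ν - β z * F′)) (y-suc ν) ⟨
    P m * F + - # 16 * cubes n ν + (B n ν - B n (suc ν)) ∎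
    where
    N = ι (suc n)
    A = m + c + 1ℚ
    β : ℚ → ℚ
    β c = (# 4 * c - # 2) * (# 10 * (m + c) * (m + c) - # 5 * (m + c) * (c - 1ℚ) + (c - 1ℚ) * (c - 1ℚ))
    binomial : ∀ m c G → (m + 1ℚ) * (m + 1ℚ) * (m + 1ℚ) * (m + 1ℚ) * (m + 1ℚ) * G ≡
      ((m + c + 1ℚ) * (m + c + 1ℚ) - # 5 * (m + c + 1ℚ) * c + # 10 * c * c) * ((m + c + 1ℚ) * (m + c + 1ℚ) * (m + c + 1ℚ) * G) -
      (# 10 * (m + c + 1ℚ) * (m + c + 1ℚ) - # 5 * (m + c + 1ℚ) * c + c * c) * (c * c * c * G)
    binomial = solve-∀ ring
    collect : ∀ m c F F′ →
      ((m + c + 1ℚ) * (m + c + 1ℚ) - # 5 * (m + c + 1ℚ) * c + # 10 * c * c) * ((# 4 * (m + c) + # 2) * F) -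
      (# 10 * (m + c + 1ℚ) * (m + c + 1ℚ) - # 5 * (m + c + 1ℚ) * c + c * c) * ((# 4 * c + # 2) * F′) ≡
      (# 20 * (m * m * m) + # 30 * (m * m) + # 18 * m + # 4) * F +
      - # 16 * (((m + c) * (m + c) * (m + c) - c * c * c) * F) +
      ((# 4 * c - # 2) * (# 10 * (m + c) * (m + c) - # 5 * (m + c) * (c - 1ℚ) + (c - 1ℚ) * (c - 1ℚ)) * F -
       (# 4 * (c + 1ℚ) - # 2) * (# 10 * (m + (c + 1ℚ)) * (m + (c + 1ℚ)) - # 5 * (m + (c + 1ℚ)) * ((c + 1ℚ) - 1ℚ) + ((c + 1ℚ) - 1ℚ) * ((c + 1ℚ) - 1ℚ)) * F′)
    collect = solve-∀ ring

  cubes-suc : cubes (suc n) ν ≡ # 4 * ι (suc n) * F + (C n ν - C n (suc ν))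
  cubes-suc = begin-equality
    cubes (suc n) ν
      ≡⟨ cong (λ z → (z * z * z - c * c * c) * G) (trans (cong (_+ c) (ι-suc n)) (swap m c)) ⟩
    ((a + 1ℚ) * (a + 1ℚ) * (a + 1ℚ) - c * c * c) * G
      ≡⟨ distrib ((a + 1ℚ) * (a + 1ℚ) * (a + 1ℚ)) (c * c * c) G ⟩
    (a + 1ℚ) * (a + 1ℚ) * (a + 1ℚ) * G - c * c * c * G
      ≡⟨ cong₂ _-_ f-suc-y f-suc-shift-y ⟩
    (# 4 * a + # 2) * F - (# 4 * c + # 2) * F′
      ≡⟨ collect m c F F′ ⟩
    # 4 * (m + 1ℚ) * F + (C n ν - (# 4 * (c + 1ℚ) - # 2) * F′)
      ≡⟨ cong₂ (λ x z → # 4 * x * F + (C n ν - (# 4 * z - # 2) * F′)) (ι-suc n) (y-suc ν) ⟨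
    # 4 * ι (suc n) * F + (C n ν - C n (suc ν)) ∎
    where
    swap : ∀ m c → m + 1ℚ + c ≡ m + c + 1ℚ
    swap = solve-∀ ring
    distrib : ∀ a b c → (a - b) * c ≡ a * c - b * c
    distrib = solve-∀ ring
    collect : ∀ m c F F′ → (# 4 * (m + c) + # 2) * F - (# 4 * c + # 2) * F′ ≡
      # 4 * (m + 1ℚ) * F + ((# 4 * c - # 2) * F - (# 4 * (c + 1ℚ) - # 2) * F′)
    collect = solve-∀ ring

-- Sums over ν < M and their recurrence up to boundary terms

Σ< : (ℕ → ℚ) → ℕ → ℚ
Σ< h zero    = 0ℚ
Σ< h (suc M) = Σ< h M + h M

Σ<-cong : ∀ {g h} → (∀ ν → g ν ≡ h ν) → ∀ M → Σ< g M ≡ Σ< h M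
Σ<-cong g≗h zero    = refl
Σ<-cong g≗h (suc M) = cong₂ _+_ (Σ<-cong g≗h M) (g≗h M)

Σ<-+ : ∀ g h M → Σ< (λ ν → g ν + h ν) M ≡ Σ< g M + Σ< h M
Σ<-+ g h zero    = refl
Σ<-+ g h (suc M) = trans (cong (_+ (g M + h M)) (Σ<-+ g h M)) (interchange (Σ< g M) (Σ< h M) (g M) (h M))

Σ<-* : ∀ c h M → Σ< (λ ν → c * h ν) M ≡ c * Σ< h M
Σ<-* c h zero    = sym (*-zeroʳ c)
Σ<-* c h (suc M) = trans (cong (_+ c * h M) (Σ<-* c h M)) (sym (*-distribˡ-+ c (Σ< h M) (h M)))

Σ<-telescope : ∀ (h : ℕ → ℚ) M → Σ< (λ ν → h ν - h (suc ν)) M ≡ h 0 - h M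
Σ<-telescope h zero    = sym (+-inverseʳ (h 0))
Σ<-telescope h (suc M) = trans (cong (_+ (h M - h (suc M))) (Σ<-telescope h M)) (cancel (h 0) (h M) (h (suc M)))
  where
  cancel : ∀ a b c → a - b + (b - c) ≡ a - c
  cancel = solve-∀ ring

s : ℕ → ℕ → ℚ
s n = Σ< (f n)

-- This zero removes the lower boundary term of both telescoping sums.
4y0-2≡0 : # 4 * y 0 - # 2 ≡ 0ℚ
4y0-2≡0 = cong (λ x → # 4 * (x + ½) - # 2) (ι≡# 0)

B-zero : ∀ n → B n 0 ≡ 0ℚ
B-zero n = trans (cong (λ z → z * r * f n 0) 4y0-2≡0) (trans (cong (_* f n 0) (*-zeroˡ r)) (*-zeroˡ (f n 0)))
  where
  c = y 0
  r = # 10 * (ι n + c) * (ι n + c) - # 5 * (ι n + c) * (c - 1ℚ) + (c - 1ℚ) * (c - 1ℚ)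

C-zero : ∀ n → C n 0 ≡ 0ℚ
C-zero n = trans (cong (_* f n 0) 4y0-2≡0) (*-zeroˡ (f n 0))

s-rec-cubes : ∀ n M → let N = ι (suc n) in
  N * N * N * N * N * s (suc n) M ≡ P (ι n) * s n M + - # 16 * Σ< (cubes n) M - B n M
s-rec-cubes n M = begin-equality
  N * N * N * N * N * s (suc n) M
    ≡⟨ Σ<-* (N * N * N * N * N) (f (suc n)) M ⟨
  Σ< (λ ν → N * N * N * N * N * f (suc n) ν) M
    ≡⟨ Σ<-cong (f-rec n) M ⟩
  Σ< (λ ν → P (ι n) * f n ν + - # 16 * cubes n ν + (B n ν - B n (suc ν))) M
    ≡⟨ Σ<-+ (λ ν → P (ι n) * f n ν + - # 16 * cubes n ν) (λ ν → B n ν - B n (suc ν)) M ⟩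
  Σ< (λ ν → P (ι n) * f n ν + - # 16 * cubes n ν) M + Σ< (λ ν → B n ν - B n (suc ν)) M
    ≡⟨ cong₂ _+_
         (trans (Σ<-+ (λ ν → P (ι n) * f n ν) (λ ν → - # 16 * cubes n ν) M)
           (cong₂ _+_ (Σ<-* (P (ι n)) (f n) M) (Σ<-* (- # 16) (cubes n) M)))
         (trans (Σ<-telescope (B n) M) (trans (cong (_- B n M) (B-zero n)) (+-identityˡ (- B n M)))) ⟩
  P (ι n) * s n M + - # 16 * Σ< (cubes n) M - B n M ∎
  where N = ι (suc n)

-- At n = 0 one has a = -b, so a³ + b³ vanishes term by term.
Σ<-cubes-zero : ∀ M → Σ< (cubes 0) M ≡ 0ℚ
Σ<-cubes-zero M = trans (Σ<-cong pointwise M) (trans (Σ<-* 0ℚ (λ _ → 0ℚ) M) (*-zeroˡ (Σ< (λ _ → 0ℚ) M)))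
  where
  cancel : ∀ c x → ((0ℚ + c) * (0ℚ + c) * (0ℚ + c) - c * c * c) * x ≡ 0ℚ
  cancel = solve-∀ ring
  pointwise : ∀ ν → cubes 0 ν ≡ 0ℚ * 0ℚ
  pointwise ν = trans (cong (λ z → ((z + y ν) * (z + y ν) * (z + y ν) - y ν * y ν * y ν) * f 0 ν) (ι≡# 0)) (cancel (y ν) (f 0 ν))

Σ<-cubes-suc : ∀ n M → Σ< (cubes (suc n)) M ≡ # 4 * ι (suc n) * s n M - C n M
Σ<-cubes-suc n M = begin-equality
  Σ< (cubes (suc n)) M
    ≡⟨ Σ<-cong (cubes-suc n) M ⟩
  Σ< (λ ν → # 4 * ι (suc n) * f n ν + (C n ν - C n (suc ν))) M
    ≡⟨ Σ<-+ (λ ν → # 4 * ι (suc n) * f n ν) (λ ν → C n ν - C n (suc ν)) M ⟩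
  Σ< (λ ν → # 4 * ι (suc n) * f n ν) M + Σ< (λ ν → C n ν - C n (suc ν)) M
    ≡⟨ cong₂ _+_ (Σ<-* (# 4 * ι (suc n)) (f n) M)
         (trans (Σ<-telescope (C n) M) (trans (cong (_- C n M) (C-zero n)) (+-identityˡ (- C n M)))) ⟩
  # 4 * ι (suc n) * s n M - C n M ∎

s-one : ∀ M → s 1 M ≡ # 4 * s 0 M - B 0 M
s-one M = begin-equality
  s 1 M                                                   ≡⟨ one (s 1 M) ⟩
  1ℚ * 1ℚ * 1ℚ * 1ℚ * 1ℚ * s 1 M                          ≡⟨ cong (λ z → z * z * z * z * z * s 1 M) (ι≡# 1) ⟨
  ι 1 * ι 1 * ι 1 * ι 1 * ι 1 * s 1 M                     ≡⟨ s-rec-cubes 0 M ⟩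
  P (ι 0) * s 0 M + - # 16 * Σ< (cubes 0) M - B 0 M       ≡⟨ cong₂ (λ x z → P x * s 0 M + - # 16 * z - B 0 M) (ι≡# 0) (Σ<-cubes-zero M) ⟩
  P 0ℚ * s 0 M + - # 16 * 0ℚ - B 0 M                      ≡⟨ cong (_- B 0 M) (+-identityʳ (# 4 * s 0 M)) ⟩
  # 4 * s 0 M - B 0 M                                     ∎
  where
  one : ∀ x → x ≡ 1ℚ * 1ℚ * 1ℚ * 1ℚ * 1ℚ * x
  one = solve-∀ ring

-- The boundary terms at M of the two telescopings; 16 is the coefficient with which the cubes enter
-- `s-rec-cubes`.
g : ℕ → ℕ → ℚ
g n M = # 16 * C n M - B (suc n) M

s-rec : ∀ n M → let m = ι (suc n) ; N = ι (suc (suc n)) in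
  N * N * N * N * N * s (suc (suc n)) M ≡ P m * s (suc n) M + - # 64 * m * s n M + g n M
s-rec n M = begin-equality
  N * N * N * N * N * s (suc (suc n)) M
    ≡⟨ s-rec-cubes (suc n) M ⟩
  P m * s (suc n) M + - # 16 * Σ< (cubes (suc n)) M - B (suc n) M
    ≡⟨ cong (λ z → P m * s (suc n) M + - # 16 * z - B (suc n) M) (Σ<-cubes-suc n M) ⟩
  P m * s (suc n) M + - # 16 * (# 4 * m * s n M - C n M) - B (suc n) M
    ≡⟨ rearrange (P m * s (suc n) M) m (s n M) (C n M) (B (suc n) M) ⟩
  P m * s (suc n) M + - # 64 * m * s n M + g n M ∎
  where
  m = ι (suc n)
  N = ι (suc (suc n))
  rearrange : ∀ p m x c b → p + - # 16 * (# 4 * m * x - c) - b ≡ p + - # 64 * m * x + (# 16 * c - b)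
  rearrange = solve-∀ ring

-- The boundary terms for large M

i^ : ℕ → ℕ → ℚ
i^ zero    M = 1ℚ
i^ (suc j) M = i M * i^ j M

0≤i^ : ∀ j M → 0ℚ ≤ i^ j M
0≤i^ zero    M = nonNegative⁻¹ 1ℚ
0≤i^ (suc j) M = 0≤* (0≤i M) (0≤i^ j M)

-- O j h means h M = O(M⁻ʲ).
O : ℕ → (ℕ → ℚ) → Set
O j h = ∃[ K ] (∀ M → ∣ h M ∣ ≤ K * i^ j M)

O-cong : ∀ {j g h} → (∀ M → h M ≡ g M) → O j g → O j h
O-cong h≗g (K , bound) = K , λ M → ≤-trans (≤-reflexive (cong ∣_∣ (h≗g M))) (bound M)

O-+ : ∀ {j g h} → O j g → O j h → O j (λ M → g M + h M)
O-+ {j} {g} {h} (K , g≤) (L , h≤) = K + L , λ M → ≤-trans (∣p+q∣≤∣p∣+∣q∣ (g M) (h M))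
  (≤-trans (+-mono-≤ (g≤ M) (h≤ M)) (≤-reflexive (sym (*-distribʳ-+ (i^ j M) K L))))

O-* : ∀ {j h} c → O j h → O j (λ M → c * h M)
O-* {j} {h} c (K , h≤) = ∣ c ∣ * K , λ M → ≤-trans (≤-reflexive (∣p*q∣≡∣p∣*∣q∣ c (h M)))
  (≤-trans (*-monoˡ (0≤∣p∣ c) (h≤ M)) (≤-reflexive (sym (*-assoc ∣ c ∣ K (i^ j M)))))

O-y : ∀ {j h} → O (suc j) h → O j (λ M → y M * h M)
O-y {j} {h} (K , h≤) = K , bound
  where
  rearrange : ∀ y k r p → y * (k * (r * p)) ≡ k * p * (y * r)
  rearrange = solve-∀ ring
  bound : ∀ M → ∣ y M * h M ∣ ≤ K * i^ j M
  bound M = begin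
    ∣ y M * h M ∣               ≡⟨ trans (∣p*q∣≡∣p∣*∣q∣ (y M) (h M)) (cong (_* ∣ h M ∣) (0≤p⇒∣p∣≡p (0≤y M))) ⟩
    y M * ∣ h M ∣               ≤⟨ *-monoˡ (0≤y M) (h≤ M) ⟩
    y M * (K * (i M * i^ j M))  ≡⟨ rearrange (y M) K (i M) (i^ j M) ⟩
    K * i^ j M * (y M * i M)    ≡⟨ trans (cong (K * i^ j M *_) (y*i M)) (*-identityʳ (K * i^ j M)) ⟩
    K * i^ j M                  ∎

O-weaken : ∀ {j h} → O (suc j) h → O j h
O-weaken {j} {h} (K , h≤) = ∣ K ∣ * # 2 , bound
  where
  bound : ∀ M → ∣ h M ∣ ≤ ∣ K ∣ * # 2 * i^ j M
  bound M = begin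
    ∣ h M ∣                   ≤⟨ h≤ M ⟩
    K * (i M * i^ j M)        ≤⟨ *-monoʳ (0≤* (0≤i M) (0≤i^ j M)) (p≤∣p∣ K) ⟩
    ∣ K ∣ * (i M * i^ j M)    ≤⟨ *-monoˡ (0≤∣p∣ K) (*-monoʳ (0≤i^ j M) (i≤2 M)) ⟩
    ∣ K ∣ * (# 2 * i^ j M)    ≡⟨ *-assoc ∣ K ∣ (# 2) (i^ j M) ⟨
    ∣ K ∣ * # 2 * i^ j M      ∎

O-i^ : ∀ j → O j (i^ j)
O-i^ j = 1ℚ , λ M → ≤-reflexive (trans (0≤p⇒∣p∣≡p (0≤i^ j M)) (sym (*-identityˡ (i^ j M))))

0≤κ : ∀ k → 0ℚ ≤ κ k
0≤κ k = 0≤* (0≤* (nonNegative⁻¹ (# 4)) (0≤ι k)) (0≤* (0≤* (0≤i k) (0≤i k)) (0≤i k))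

0≤f : ∀ n ν → 0ℚ ≤ f n ν
0≤f zero    ν = 0≤* (0≤* (0≤i ν) (0≤i ν)) (0≤i ν)
0≤f (suc n) ν = 0≤* (0≤f n ν) (0≤κ (suc (n ℕ.+ ν)))

κ≤4i² : ∀ k → κ k ≤ # 4 * (i k * i k)
κ≤4i² k = ≤-trans (≤-reflexive (rearrange (ι k) (i k)))
  (≤-trans (*-monoˡ (0≤* (nonNegative⁻¹ (# 4)) (0≤* (0≤i k) (0≤i k))) (ι*i≤1 k)) (≤-reflexive (*-identityʳ _)))
  where
  rearrange : ∀ k r → # 4 * k * (r * r * r) ≡ # 4 * (r * r) * (k * r)
  rearrange = solve-∀ ring

*-mono : ∀ {p q r t} → 0ℚ ≤ r → 0ℚ ≤ q → p ≤ q → r ≤ t → p * r ≤ q * t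
*-mono 0≤r 0≤q p≤q r≤t = ≤-trans (*-monoʳ 0≤r p≤q) (*-monoˡ 0≤q r≤t)

-- The true order of `f (suc n)` is 5 + 2n, but 5 is enough against the cubic weight in `B`. So
-- beyond the base case each new `κ` is merely bounded by 4 · 2² = 16.
O-f : ∀ n → O 5 (f (suc n))
O-f zero = # 4 , λ M → begin
  ∣ f 1 M ∣                                   ≡⟨ 0≤p⇒∣p∣≡p (0≤f 1 M) ⟩
  f 0 M * κ (suc M)                           ≤⟨ *-monoˡ (0≤f 0 M) (≤-trans (κ≤4i² (suc M)) (*-monoˡ (nonNegative⁻¹ (# 4))
                                                   (*-mono (0≤i (suc M)) (0≤i M) (i-anti M) (i-anti M)))) ⟩
  i M * i M * i M * (# 4 * (i M * i M))       ≡⟨ rearrange (i M) ⟩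
  # 4 * i^ 5 M                                ∎
  where
  rearrange : ∀ r → r * r * r * (# 4 * (r * r)) ≡ # 4 * (r * (r * (r * (r * (r * 1ℚ)))))
  rearrange = solve-∀ ring
O-f (suc n) = let K , f≤ = O-f n in # 16 * K , λ M → let k = suc (suc n ℕ.+ M) in begin
  ∣ f (suc (suc n)) M ∣      ≡⟨ 0≤p⇒∣p∣≡p (0≤f (suc (suc n)) M) ⟩
  f (suc n) M * κ k          ≤⟨ *-monoˡ (0≤f (suc n) M) (κ≤4i² k) ⟩
  f (suc n) M * (# 4 * (i k * i k))   ≤⟨ *-monoˡ (0≤f (suc n) M) (*-monoˡ (nonNegative⁻¹ (# 4)) (*-mono (0≤i k) (nonNegative⁻¹ (# 2)) (i≤2 k) (i≤2 k))) ⟩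
  f (suc n) M * # 16         ≡⟨ *-comm (f (suc n) M) (# 16) ⟩
  # 16 * f (suc n) M         ≡⟨ cong (# 16 *_) (0≤p⇒∣p∣≡p (0≤f (suc n) M)) ⟨
  # 16 * ∣ f (suc n) M ∣     ≤⟨ *-monoˡ (nonNegative⁻¹ (# 16)) (f≤ M) ⟩
  # 16 * (K * i^ 5 M)        ≡⟨ *-assoc (# 16) K (i^ 5 M) ⟨
  # 16 * K * i^ 5 M          ∎

O-C : ∀ n → O 1 (C n)
O-C n = O-cong {j = 1} {g = λ M → # 4 * (y M * f n M) + - # 2 * f n M} (λ M → expand (y M) (f n M))
  (O-+ {1} (O-* {1} (# 4) (O-y {1} (O₂ n))) (O-* {1} (- # 2) (O-weaken {1} (O₂ n))))
  where
  expand : ∀ c x → (# 4 * c - # 2) * x ≡ # 4 * (c * x) + - # 2 * x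
  expand = solve-∀ ring
  O₂ : ∀ n → O 2 (f n)
  O₂ zero    = O-weaken {2} (O-cong {3} (λ M → expand₃ (i M)) (O-i^ 3))
    where
    expand₃ : ∀ r → r * r * r ≡ r * (r * (r * 1ℚ))
    expand₃ = solve-∀ ring
  O₂ (suc n) = O-weaken {2} (O-weaken {3} (O-weaken {4} (O-f n)))

O-B : ∀ n → O 1 (B (suc n))
O-B n = O-cong {1} (λ M → expand (ι (suc n)) (y M) (f (suc n) M))
  -- The weight in `B` is a cubic in `y M` with leading coefficient 4(10 - 5 + 1) = 24. Three powers
  -- off order 5 leave order 2; for `f 0`, of order 3, the cubic would balance exactly.
  (O-weaken {1} (O-+ {2} (O-+ {2} (O-+ {2}
    (O-* {2} (# 24) (O-y {2} (O-y {3} (O-y {4} (O-f n)))))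
    (O-* {2} (# 60 * m) (O-weaken {2} (O-y {3} (O-y {4} (O-f n))))))
    (O-* {2} (# 40 * m * m - # 10 * m - # 2) (O-weaken {2} (O-weaken {3} (O-y {4} (O-f n))))))
    (O-* {2} (- # 2 * (# 10 * m * m + # 5 * m + 1ℚ)) (O-weaken {2} (O-weaken {3} (O-weaken {4} (O-f n)))))))
  where
  m = ι (suc n)
  expand : ∀ m c x → (# 4 * c - # 2) * (# 10 * (m + c) * (m + c) - # 5 * (m + c) * (c - 1ℚ) + (c - 1ℚ) * (c - 1ℚ)) * x ≡
    # 24 * (c * (c * (c * x))) + # 60 * m * (c * (c * x)) + (# 40 * m * m - # 10 * m - # 2) * (c * x) +
    - # 2 * (# 10 * m * m + # 5 * m + 1ℚ) * x
  expand = solve-∀ ring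

O-g : ∀ n → O 1 (g n)
O-g n = O-cong {1} (λ M → expand (C n M) (B (suc n) M)) (O-+ {1} (O-* {1} (# 16) (O-C n)) (O-* {1} (- 1ℚ) (O-B n)))
  where
  expand : ∀ c b → # 16 * c - b ≡ # 16 * c + - 1ℚ * b
  expand = solve-∀ ring

-- B 0 is the only boundary term that does not tend to 0; its limit 24 fixes the
-- constant in the theorem.
O-B0 : O 1 (λ M → # 24 - B 0 M)
O-B0 = O-cong {1} eq (O-+ {1} (O-* {1} (# 2) (O-weaken {1} (O-i^ 2))) (O-* {1} (# 2) (O-weaken {1} (O-weaken {2} (O-i^ 3)))))
  where
  expand : ∀ c r → # 24 - (# 4 * c - # 2) * (# 10 * (0ℚ + c) * (0ℚ + c) - # 5 * (0ℚ + c) * (c - 1ℚ) + (c - 1ℚ) * (c - 1ℚ)) * (r * r * r) ≡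
    # 24 - # 24 * ((c * r) * (c * r) * (c * r)) + # 2 * (c * r) * (r * r) + # 2 * (r * r * r)
  expand = solve-∀ ring
  collect : ∀ r → # 24 - # 24 * (1ℚ * 1ℚ * 1ℚ) + # 2 * 1ℚ * (r * r) + # 2 * (r * r * r) ≡
    # 2 * (r * (r * 1ℚ)) + # 2 * (r * (r * (r * 1ℚ)))
  collect = solve-∀ ring
  eq : ∀ M → # 24 - B 0 M ≡ # 2 * i^ 2 M + # 2 * i^ 3 M
  eq M = begin-equality
    # 24 - B 0 M
      ≡⟨ cong (λ z → # 24 - (# 4 * y M - # 2) * (# 10 * (z + y M) * (z + y M) - # 5 * (z + y M) * (y M - 1ℚ) + (y M - 1ℚ) * (y M - 1ℚ)) * f 0 M) (ι≡# 0) ⟩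
    _ ≡⟨ expand (y M) (i M) ⟩
    _ ≡⟨ cong (λ z → # 24 - # 24 * (z * z * z) + # 2 * z * (i M * i M) + # 2 * (i M * i M * i M)) (y*i M) ⟩
    _ ≡⟨ collect (i M) ⟩
    # 2 * i^ 2 M + # 2 * i^ 3 M ∎

-- The Casoratian and the partial sums of the series

d : ℕ → ℚ
d n = ι (D n)

σ : ℕ → ℕ → ℚ
σ n M = φ n * s n M

w : ℕ → ℕ → ℚ
w n M = d n * σ (suc n) M - d (suc n) * σ n M

φ≡1 : ∀ n → n ! ≡ 1 → φ n ≡ 1ℚ
φ≡1 n n!≡1 = cong (λ x → x * x) (trans (cong ι n!≡1) (ι≡# 1))

σ-zero : ∀ M → σ 0 M ≡ s 0 M
σ-zero M = trans (cong (_* s 0 M) (φ≡1 0 refl)) (*-identityˡ (s 0 M))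

-- D n and σ n M satisfy the same recurrence up to g, so their Casoratian is
-- explicit up to O(1/M).
casoratian : ∀ n → let N = ι (suc n) in O 1 (λ M → N * N * N * w n M + # 24 * ι (64 ℕ.^ n))
casoratian zero = O-cong {1} eq O-B0
  where
  simplify : ∀ x b → 1ℚ * 1ℚ * 1ℚ * (1ℚ * (# 4 * x - b) - # 4 * x) + # 24 * 1ℚ ≡ # 24 - b
  simplify = solve-∀ ring
  eq : ∀ M → ι 1 * ι 1 * ι 1 * w 0 M + # 24 * ι 1 ≡ # 24 - B 0 M
  eq M = begin-equality
    -- `D 0` and `D 1` compute to 1 and 4; the 4 matches the coefficient in `s-one`, so `s 0 M`
    -- drops out and only `B 0 M` remains.
    ι 1 * ι 1 * ι 1 * (ι 1 * (φ 1 * s 1 M) - ι 4 * (φ 0 * s 0 M)) + # 24 * ι 1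
      ≡⟨ cong₂ (λ x y → x * x * x * (x * y - ι 4 * (φ 0 * s 0 M)) + # 24 * x) (ι≡# 1)
           (trans (cong₂ _*_ (φ≡1 1 refl) (s-one M)) (*-identityˡ (# 4 * s 0 M - B 0 M))) ⟩
    1ℚ * 1ℚ * 1ℚ * (1ℚ * (# 4 * s 0 M - B 0 M) - ι 4 * (φ 0 * s 0 M)) + # 24 * 1ℚ
      ≡⟨ cong₂ (λ x y → 1ℚ * 1ℚ * 1ℚ * (1ℚ * (# 4 * s 0 M - B 0 M) - x * y) + # 24 * 1ℚ) (ι≡# 4) (σ-zero M) ⟩
    1ℚ * 1ℚ * 1ℚ * (1ℚ * (# 4 * s 0 M - B 0 M) - # 4 * s 0 M) + # 24 * 1ℚ
      ≡⟨ simplify (s 0 M) (B 0 M) ⟩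
    # 24 - B 0 M ∎
casoratian (suc n) = O-cong {1} eq (O-+ {1} (O-* {1} (# 64) (casoratian n)) (O-* {1} (d (suc n) * φ (suc n)) (O-g n)))
  where
  m = ι (suc n)
  N = ι (suc (suc n))
  regroup : ∀ N d d″ σ′ σ″ e → N * N * N * (d * σ″ - d″ * σ′) + e ≡ d * (N * N * N * σ″) - N * N * N * d″ * σ′ + e
  regroup = solve-∀ ring
  -- The terms with P cancel in the determinant, leaving 64 times the expression at n plus the
  -- boundary term.
  simplify : ∀ p m d d′ x x′ q g e → d′ * (p * x′ + - # 64 * (m * m * m) * x + q * g) - (p * d′ + - # 64 * (m * m * m) * d) * x′ + # 24 * (# 64 * e) ≡
    # 64 * (m * m * m * (d * x′ - d′ * x) + # 24 * e) + d′ * q * g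
  simplify = solve-∀ ring
  eq : ∀ M → N * N * N * w (suc n) M + # 24 * ι (64 ℕ.^ suc n) ≡
    # 64 * (m * m * m * w n M + # 24 * ι (64 ℕ.^ n)) + d (suc n) * φ (suc n) * g n M
  eq M = begin-equality
    N * N * N * w (suc n) M + # 24 * ι (64 ℕ.^ suc n)
      ≡⟨ regroup N (d (suc n)) (d (suc (suc n))) (σ (suc n) M) (σ (suc (suc n)) M) (# 24 * ι (64 ℕ.^ suc n)) ⟩
    d (suc n) * (N * N * N * σ (suc (suc n)) M) - N * N * N * d (suc (suc n)) * σ (suc n) M + # 24 * ι (64 ℕ.^ suc n)
      ≡⟨ cong₂ (λ x y → d (suc n) * x - y * σ (suc n) M + # 24 * ι (64 ℕ.^ suc n))
           (rescale n (s n M) (s (suc n) M) (s (suc (suc n)) M) (g n M) (s-rec n M)) (D-rec n) ⟩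
    d (suc n) * (P m * σ (suc n) M + - # 64 * (m * m * m) * σ n M + φ (suc n) * g n M) -
      (P m * d (suc n) + - # 64 * (m * m * m) * d n) * σ (suc n) M + # 24 * ι (64 ℕ.^ suc n)
      ≡⟨ cong (λ e → d (suc n) * (P m * σ (suc n) M + - # 64 * (m * m * m) * σ n M + φ (suc n) * g n M) -
           (P m * d (suc n) + - # 64 * (m * m * m) * d n) * σ (suc n) M + # 24 * e)
           (trans (ι-* 64 (64 ℕ.^ n)) (cong (_* ι (64 ℕ.^ n)) (ι≡# 64))) ⟩
    d (suc n) * (P m * σ (suc n) M + - # 64 * (m * m * m) * σ n M + φ (suc n) * g n M) -
      (P m * d (suc n) + - # 64 * (m * m * m) * d n) * σ (suc n) M + # 24 * (# 64 * ι (64 ℕ.^ n))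
      ≡⟨ simplify (P m) m (d n) (d (suc n)) (σ n M) (σ (suc n) M) (φ (suc n)) (g n M) (ι (64 ℕ.^ n)) ⟩
    # 64 * (m * m * m * w n M + # 24 * ι (64 ℕ.^ n)) + d (suc n) * φ (suc n) * g n M ∎

ι-cube : ∀ n → ι (n ℕ.^ 3) ≡ ι n * ι n * ι n
ι-cube n = begin-equality
  ι (n ℕ.* (n ℕ.* (n ℕ.* 1)))  ≡⟨ cong (λ m → ι (n ℕ.* (n ℕ.* m))) (ℕ.*-identityʳ n) ⟩
  ι (n ℕ.* (n ℕ.* n))          ≡⟨ trans (ι-* n (n ℕ.* n)) (cong (ι n *_) (ι-* n n)) ⟩
  ι n * (ι n * ι n)            ≡⟨ *-assoc (ι n) (ι n) (ι n) ⟨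
  ι n * ι n * ι n              ∎

domb-term-eq : ∀ n → let N = ι (suc n) in
  N * N * N * d (suc n) * d n * domb-term (suc n) ≡ # 64 * ι (64 ℕ.^ n)
domb-term-eq n = begin-equality
  N * N * N * d (suc n) * d n * domb-term (suc n)
    ≡⟨ cong (_* domb-term (suc n)) (trans (ι-* (suc n ℕ.^ 3 ℕ.* D (suc n)) (D n))
         (cong (_* d n) (trans (ι-* (suc n ℕ.^ 3) (D (suc n))) (cong (_* d (suc n)) (ι-cube (suc n)))))) ⟨
  ι (suc n ℕ.^ 3 ℕ.* D (suc n) ℕ.* D n) * domb-term (suc n)
    ≡⟨ ι-/ (64 ℕ.^ suc n) (suc n ℕ.^ 3 ℕ.* D (suc n) ℕ.* D n) {{ℕ.m*n≢0 (suc n ℕ.^ 3 ℕ.* D (suc n)) (D n)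
         {{ℕ.m*n≢0 (suc n ℕ.^ 3) (D (suc n)) {{ℕ.m^n≢0 (suc n) 3}} {{D≢0 (suc n)}}}} {{D≢0 n}}}} ⟩
  ι (64 ℕ.^ suc n)
    ≡⟨ trans (ι-* 64 (64 ℕ.^ n)) (cong (_* ι (64 ℕ.^ n)) (ι≡# 64)) ⟩
  # 64 * ι (64 ℕ.^ n) ∎
  where N = ι (suc n)

-- This is 24/64: the Casoratian carries 24 · 64ⁿ, while the term of the series at n+1 carries
-- 64ⁿ⁺¹.
⅜ : ℚ
⅜ = + 3 / 8

-- Divided by `d n * d (suc n)`, the Casoratian is the increment of σₙ/Dₙ, and it equals -3/8 of the
-- next term of the series up to O(1/M). The increments add up from σ₀/D₀ = σ₀; the result is
-- multiplied through by `d n`.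
σ-asymptotics : ∀ n → O 1 (λ M → σ n M - d n * (s 0 M - ⅜ * ∑ domb-term n))
σ-asymptotics zero = O-cong {1} eq (O-* {1} 0ℚ (O-i^ 1))
  where
  cancel : ∀ x r → x - 1ℚ * (x - ⅜ * 0ℚ) ≡ 0ℚ * (r * 1ℚ)
  cancel = solve-∀ ring
  eq : ∀ M → σ 0 M - ι 1 * (s 0 M - ⅜ * 0ℚ) ≡ 0ℚ * i^ 1 M
  eq M = trans (cong₂ (λ x y → x - y * (s 0 M - ⅜ * 0ℚ)) (σ-zero M) (ι≡# 1)) (cancel (s 0 M) (i M))
σ-asymptotics (suc n) = O-cong {1} eq (O-* {1} q (O-+ {1} (casoratian n) (O-* {1} (N * N * N * d (suc n)) (σ-asymptotics n))))
  where
  N = ι (suc n)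
  T = ∑ domb-term n
  τ = domb-term (suc n)
  instance
    nz : NonZero (suc n ℕ.^ 3 ℕ.* D n)
    nz = ℕ.m*n≢0 (suc n ℕ.^ 3) (D n) {{ℕ.m^n≢0 (suc n) 3}} {{D≢0 n}}
  q = + 1 / (suc n ℕ.^ 3 ℕ.* D n)
  q-inverse : N * N * N * d n * q ≡ 1ℚ
  q-inverse = begin-equality
    N * N * N * d n * q              ≡⟨ cong (_* q) (trans (ι-* (suc n ℕ.^ 3) (D n)) (cong (_* d n) (ι-cube (suc n)))) ⟨
    ι (suc n ℕ.^ 3 ℕ.* D n) * q      ≡⟨ ι-/ 1 (suc n ℕ.^ 3 ℕ.* D n) ⟩
    ι 1                              ≡⟨ ι≡# 1 ⟩
    1ℚ                               ∎
  regroup : ∀ q N d d′ x x′ S T τ → N * N * N * d * q * (x′ - d′ * (S - ⅜ * (T + τ))) ≡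
    q * (N * N * N * (d * x′ - d′ * x) + ⅜ * (N * N * N * d′ * d * τ) + N * N * N * d′ * (x - d * (S - ⅜ * T)))
  regroup = solve-∀ ring
  ⅜*64 : ∀ x → ⅜ * (# 64 * x) ≡ # 24 * x
  ⅜*64 = solve-∀ ring
  eq : ∀ M → σ (suc n) M - d (suc n) * (s 0 M - ⅜ * (T + τ)) ≡
    q * (N * N * N * w n M + # 24 * ι (64 ℕ.^ n) + N * N * N * d (suc n) * (σ n M - d n * (s 0 M - ⅜ * T)))
  eq M = begin-equality
    σ (suc n) M - d (suc n) * (s 0 M - ⅜ * (T + τ))
      ≡⟨ *-identityˡ (σ (suc n) M - d (suc n) * (s 0 M - ⅜ * (T + τ))) ⟨
    1ℚ * (σ (suc n) M - d (suc n) * (s 0 M - ⅜ * (T + τ)))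
      ≡⟨ cong (_* (σ (suc n) M - d (suc n) * (s 0 M - ⅜ * (T + τ)))) q-inverse ⟨
    N * N * N * d n * q * (σ (suc n) M - d (suc n) * (s 0 M - ⅜ * (T + τ)))
      ≡⟨ regroup q N (d n) (d (suc n)) (σ n M) (σ (suc n) M) (s 0 M) T τ ⟩
    q * (N * N * N * w n M + ⅜ * (N * N * N * d (suc n) * d n * τ) + N * N * N * d (suc n) * (σ n M - d n * (s 0 M - ⅜ * T)))
      ≡⟨ cong (λ z → q * (N * N * N * w n M + z + N * N * N * d (suc n) * (σ n M - d n * (s 0 M - ⅜ * T))))
           (trans (cong (⅜ *_) (domb-term-eq n)) (⅜*64 (ι (64 ℕ.^ n)))) ⟩
    q * (N * N * N * w n M + # 24 * ι (64 ℕ.^ n) + N * N * N * d (suc n) * (σ n M - d n * (s 0 M - ⅜ * T))) ∎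

-- Decay of σₙ/Dₙ, uniformly in M

Σ<-mono : ∀ {g h} → (∀ ν → g ν ≤ h ν) → ∀ M → Σ< g M ≤ Σ< h M
Σ<-mono g≤h zero    = ≤-refl
Σ<-mono g≤h (suc M) = +-mono-≤ (Σ<-mono g≤h M) (g≤h M)

0≤φ : ∀ n → 0ℚ ≤ φ n
0≤φ n = 0≤* (0≤ι (n !)) (0≤ι (n !))

ι-mono : ∀ {m n} → m ℕ.≤ n → ι m ≤ ι n
ι-mono {m} {n} m≤n = subst (ι m ≤_) (trans (sym (ι-+ m (n ℕ.∸ m))) (cong ι (ℕ.m+[n∸m]≡n m≤n))) (p≤p+q (ι m) (0≤ι (n ℕ.∸ m)))

-- `κ k` is 4k/(k+½)³, and both n and k are at most k+½. The left side is the factor gained by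
-- `φ n * f n ν` when the index rises to n.
n²κ≤4 : ∀ n k → n ℕ.≤ k → ι n * ι n * κ k ≤ # 4
n²κ≤4 n k n≤k = begin
  ι n * ι n * κ k                          ≡⟨ rearrange (ι n) (ι k) (i k) ⟩
  # 4 * (ι n * i k * (ι n * i k * (ι k * i k)))  ≤⟨ *-monoˡ (nonNegative⁻¹ (# 4)) (*-mono 0≤ni*ki 0≤1 ni≤1 (*-mono 0≤ki 0≤1 ni≤1 (ι*i≤1 k))) ⟩
  # 4 * (1ℚ * (1ℚ * 1ℚ))                   ≡⟨⟩
  # 4                                      ∎
  where
  rearrange : ∀ n k r → n * n * (# 4 * k * (r * r * r)) ≡ # 4 * (n * r * (n * r * (k * r)))
  rearrange = solve-∀ ring
  0≤1 : 0ℚ ≤ 1ℚ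
  0≤1 = nonNegative⁻¹ 1ℚ
  0≤ki : 0ℚ ≤ ι k * i k
  0≤ki = 0≤* (0≤ι k) (0≤i k)
  0≤ni*ki : 0ℚ ≤ ι n * i k * (ι k * i k)
  0≤ni*ki = 0≤* (0≤* (0≤ι n) (0≤i k)) 0≤ki
  ni≤1 : ι n * i k ≤ 1ℚ
  ni≤1 = ≤-trans (*-monoʳ (0≤i k) (ι-mono n≤k)) (ι*i≤1 k)

φ*f≤ : ∀ n ν → φ n * f n ν ≤ ι (4 ℕ.^ n) * f 0 ν
φ*f≤ zero    ν = ≤-reflexive (cong (_* f 0 ν) (trans (φ≡1 0 refl) (sym (ι≡# 1))))
φ*f≤ (suc n) ν = begin
  φ (suc n) * (f n ν * κ k)                      ≡⟨ cong (_* (f n ν * κ k)) (φ-suc n) ⟩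
  ι (suc n) * ι (suc n) * φ n * (f n ν * κ k)    ≡⟨ regroup (ι (suc n)) (φ n) (f n ν) (κ k) ⟩
  φ n * f n ν * (ι (suc n) * ι (suc n) * κ k)    ≤⟨ *-monoˡ (0≤* (0≤φ n) (0≤f n ν)) (n²κ≤4 (suc n) k (ℕ.s≤s (ℕ.m≤m+n n ν))) ⟩
  φ n * f n ν * # 4                              ≤⟨ *-monoʳ (nonNegative⁻¹ (# 4)) (φ*f≤ n ν) ⟩
  ι (4 ℕ.^ n) * f 0 ν * # 4                      ≡⟨ swap (ι (4 ℕ.^ n)) (f 0 ν) (# 4) ⟩
  # 4 * ι (4 ℕ.^ n) * f 0 ν                      ≡⟨ cong (_* f 0 ν) (trans (ι-* 4 (4 ℕ.^ n)) (cong (_* ι (4 ℕ.^ n)) (ι≡# 4))) ⟨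
  ι (4 ℕ.^ suc n) * f 0 ν                        ∎
  where
  k = suc (n ℕ.+ ν)
  regroup : ∀ m p f k → m * m * p * (f * k) ≡ p * f * (m * m * k)
  regroup = solve-∀ ring
  swap : ∀ a b c → a * b * c ≡ c * a * b
  swap = solve-∀ ring

σ≤ : ∀ n M → σ n M ≤ ι (4 ℕ.^ n) * s 0 M
σ≤ n M = begin
  φ n * s n M                          ≡⟨ Σ<-* (φ n) (f n) M ⟨
  Σ< (λ ν → φ n * f n ν) M             ≤⟨ Σ<-mono (φ*f≤ n) M ⟩
  Σ< (λ ν → ι (4 ℕ.^ n) * f 0 ν) M     ≡⟨ Σ<-* (ι (4 ℕ.^ n)) (f 0) M ⟩
  ι (4 ℕ.^ n) * s 0 M                  ∎

0≤s : ∀ n M → 0ℚ ≤ s n M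
0≤s n zero    = ≤-refl
0≤s n (suc M) = ≤-trans (0≤s n M) (p≤p+q (s n M) (0≤f n M))

0≤p-q⇒q≤p : ∀ {p q} → 0ℚ ≤ p - q → q ≤ p
0≤p-q⇒q≤p {p} {q} 0≤p-q = subst (q ≤_) (cancel p q) (p≤p+q q 0≤p-q)
  where
  cancel : ∀ p q → q + (p - q) ≡ p
  cancel = solve-∀ ring

p≤q⇒0≤q-p : ∀ {p q} → p ≤ q → 0ℚ ≤ q - p
p≤q⇒0≤q-p {p} {q} p≤q = subst (_≤ q - p) (+-inverseʳ p) (+-monoˡ-≤ (- p) p≤q)

ι-pos : ∀ n .{{_ : NonZero n}} → Positive (ι n)
ι-pos n@(suc _) = subst Positive (sym (ι≡# n)) _

cube-pos : ∀ p .{{_ : Positive p}} → Positive (p * p * p)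
cube-pos p = pos*pos⇒pos (p * p) {{pos*pos⇒pos p p}} p

-- The ratio 8 lies strictly between the limiting roots 4 and 16, which lets the recurrence
-- reproduce it.
D-growth-step : ∀ n → # 8 * d n ≤ d (suc n) → # 8 * d (suc n) ≤ d (suc (suc n))
D-growth-step n 8dₙ≤dₙ₊₁ = 0≤p-q⇒q≤p (*-cancelˡ-≤-pos (N * N * N) {{cube-pos N {{ι-pos (suc (suc n))}}}}
  (subst₂ _≤_ (sym (*-zeroʳ (N * N * N))) (sym eq) nonneg))
  where
  k = ι n
  m = ι (suc n)
  N = ι (suc (suc n))
  -- This is P(m) - 8N³ - 8m³ with m = k+1 and N = k+2: what is left for `d (suc n)` once 8m³ of it
  -- is paired with -64m³ `d n`. In terms of k no coefficient is negative.
  c = # 4 * (k * k * k) + # 18 * (k * k) + # 18 * k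
  nonneg : 0ℚ ≤ c * d (suc n) + # 8 * (m * m * m) * (d (suc n) - # 8 * d n)
  nonneg = +-mono-≤ (0≤* (+-mono-≤ (+-mono-≤ (0≤* 0≤lit (0≤* (0≤* 0≤k 0≤k) 0≤k)) (0≤* 0≤lit (0≤* 0≤k 0≤k))) (0≤* 0≤lit 0≤k)) (0≤ι (D (suc n))))
    (0≤* (0≤* 0≤lit (0≤* (0≤* 0≤m 0≤m) 0≤m)) (p≤q⇒0≤q-p 8dₙ≤dₙ₊₁))
    where
    0≤k = 0≤ι n
    0≤m = 0≤ι (suc n)
    0≤lit : ∀ {l} → 0ℚ ≤ # l
    0≤lit {l} = nonNegative⁻¹ (# l)
  simplify : ∀ k d d′ →
    (# 20 * ((k + 1ℚ) * (k + 1ℚ) * (k + 1ℚ)) + # 30 * ((k + 1ℚ) * (k + 1ℚ)) + # 18 * (k + 1ℚ) + # 4) * d′ +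
    - # 64 * ((k + 1ℚ) * (k + 1ℚ) * (k + 1ℚ)) * d - # 8 * ((k + 1ℚ + 1ℚ) * (k + 1ℚ + 1ℚ) * (k + 1ℚ + 1ℚ)) * d′ ≡
    (# 4 * (k * k * k) + # 18 * (k * k) + # 18 * k) * d′ + # 8 * ((k + 1ℚ) * (k + 1ℚ) * (k + 1ℚ)) * (d′ - # 8 * d)
  simplify = solve-∀ ring
  distrib : ∀ N x y → N * (x - # 8 * y) ≡ N * x - # 8 * N * y
  distrib = solve-∀ ring
  eq : N * N * N * (d (suc (suc n)) - # 8 * d (suc n)) ≡ c * d (suc n) + # 8 * (m * m * m) * (d (suc n) - # 8 * d n)
  eq = begin-equality
    N * N * N * (d (suc (suc n)) - # 8 * d (suc n))
      ≡⟨ distrib (N * N * N) (d (suc (suc n))) (d (suc n)) ⟩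
    N * N * N * d (suc (suc n)) - # 8 * (N * N * N) * d (suc n)
      ≡⟨ cong (_- # 8 * (N * N * N) * d (suc n)) (D-rec n) ⟩
    P m * d (suc n) + - # 64 * (m * m * m) * d n - # 8 * (N * N * N) * d (suc n)
      ≡⟨ cong₂ (λ m N → P m * d (suc n) + - # 64 * (m * m * m) * d n - # 8 * (N * N * N) * d (suc n))
           (ι-suc n) (trans (ι-suc (suc n)) (cong (_+ 1ℚ) (ι-suc n))) ⟩
    P (k + 1ℚ) * d (suc n) + - # 64 * ((k + 1ℚ) * (k + 1ℚ) * (k + 1ℚ)) * d n - # 8 * ((k + 1ℚ + 1ℚ) * (k + 1ℚ + 1ℚ) * (k + 1ℚ + 1ℚ)) * d (suc n)
      ≡⟨ simplify k (d n) (d (suc n)) ⟩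
    c * d (suc n) + # 8 * ((k + 1ℚ) * (k + 1ℚ) * (k + 1ℚ)) * (d (suc n) - # 8 * d n)
      ≡⟨ cong (λ m → c * d (suc n) + # 8 * (m * m * m) * (d (suc n) - # 8 * d n)) (ι-suc n) ⟨
    c * d (suc n) + # 8 * (m * m * m) * (d (suc n) - # 8 * d n) ∎

-- D 1 / D 0 = 4 and D 2 / D 1 = 7, so the growth by factors of 8 starts at n = 2.
D-growth : ∀ n → # 8 * d (suc (suc n)) ≤ d (suc (suc (suc n)))
D-growth zero    = subst₂ (λ x y → # 8 * x ≤ y) (sym (ι≡# 28)) (sym (ι≡# 256)) (≤ᵇ⇒≤ _)
D-growth (suc n) = D-growth-step (suc (suc n)) (D-growth n)

-- The factor 64 makes up for the first steps, where D grows by less than 8.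
8^n≤64D : ∀ n → ι (8 ℕ.^ n) ≤ # 64 * d n
8^n≤64D 0 = subst (λ x → x ≤ # 64 * x) (sym (ι≡# 1)) (≤ᵇ⇒≤ _)
8^n≤64D 1 = subst₂ (λ x y → x ≤ # 64 * y) (sym (ι≡# 8)) (sym (ι≡# 4)) (≤ᵇ⇒≤ _)
8^n≤64D 2 = subst₂ (λ x y → x ≤ # 64 * y) (sym (ι≡# 64)) (sym (ι≡# 28)) (≤ᵇ⇒≤ _)
8^n≤64D (suc n@(suc (suc k))) = begin
  ι (8 ℕ.^ suc n)        ≡⟨ trans (ι-* 8 (8 ℕ.^ n)) (cong (_* ι (8 ℕ.^ n)) (ι≡# 8)) ⟩
  # 8 * ι (8 ℕ.^ n)      ≤⟨ *-monoˡ (nonNegative⁻¹ (# 8)) (8^n≤64D n) ⟩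
  # 8 * (# 64 * d n)     ≡⟨ swap (d n) ⟩
  # 64 * (# 8 * d n)     ≤⟨ *-monoˡ (nonNegative⁻¹ (# 64)) (D-growth k) ⟩
  # 64 * d (suc n)       ∎
  where
  swap : ∀ x → # 8 * (# 64 * x) ≡ # 64 * (# 8 * x)
  swap = solve-∀ ring

-- Trades the decay 4ⁿ/8ⁿ = 2⁻ⁿ of σₙ/Dₙ for the weaker `i n`, which `c*i-small` can handle.
y≤2^n : ∀ n → y n ≤ ι (2 ℕ.^ n)
y≤2^n zero    = subst₂ (λ x z → x + ½ ≤ z) (sym (ι≡# 0)) (sym (ι≡# 1)) (≤ᵇ⇒≤ _)
y≤2^n (suc n) = begin
  y (suc n)                        ≡⟨ y-suc n ⟩
  y n + 1ℚ                         ≤⟨ +-mono-≤ (y≤2^n n) 1≤2^n ⟩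
  ι (2 ℕ.^ n) + ι (2 ℕ.^ n)        ≡⟨ ι-+ (2 ℕ.^ n) (2 ℕ.^ n) ⟨
  ι (2 ℕ.^ n ℕ.+ 2 ℕ.^ n)          ≡⟨ cong (λ m → ι (2 ℕ.^ n ℕ.+ m)) (ℕ.+-identityʳ (2 ℕ.^ n)) ⟨
  ι (2 ℕ.^ suc n)                  ∎
  where
  1≤2^n : 1ℚ ≤ ι (2 ℕ.^ n)
  1≤2^n = subst (_≤ ι (2 ℕ.^ n)) (ι≡# 1) (ι-mono (ℕ.m^n>0 2 n))

σ-decay : ∀ n M → σ n M ≤ # 64 * d n * s 0 M * i n
σ-decay n M = begin
  σ n M                                    ≡⟨ trans (sym (*-identityʳ (σ n M))) (cong (σ n M *_) (sym (y*i n))) ⟩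
  σ n M * (y n * i n)                      ≤⟨ *-mono (0≤* (0≤y n) (0≤i n)) (0≤* (0≤ι (4 ℕ.^ n)) (0≤s 0 M)) (σ≤ n M) (*-monoʳ (0≤i n) (y≤2^n n)) ⟩
  ι (4 ℕ.^ n) * s 0 M * (ι (2 ℕ.^ n) * i n)  ≡⟨ regroup (ι (4 ℕ.^ n)) (s 0 M) (ι (2 ℕ.^ n)) (i n) ⟩
  ι (4 ℕ.^ n) * ι (2 ℕ.^ n) * s 0 M * i n  ≡⟨ cong (λ x → x * s 0 M * i n) (trans (cong ι 8^n≡4^n*2^n) (ι-* (4 ℕ.^ n) (2 ℕ.^ n))) ⟨
  ι (8 ℕ.^ n) * s 0 M * i n                ≤⟨ *-monoʳ (0≤i n) (*-monoʳ (0≤s 0 M) (8^n≤64D n)) ⟩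
  # 64 * d n * s 0 M * i n                 ∎
  where
  regroup : ∀ a b c e → a * b * (c * e) ≡ a * c * b * e
  regroup = solve-∀ ring
  8^n≡4^n*2^n : 8 ℕ.^ n ≡ 4 ℕ.^ n ℕ.* 2 ℕ.^ n
  8^n≡4^n*2^n = trans (ℕ.^-*-assoc 2 3 n) (trans (ℕ.^-distribˡ-+-* 2 n (2 ℕ.* n))
    (trans (ℕ.*-comm (2 ℕ.^ n) (2 ℕ.^ (2 ℕ.* n))) (cong (ℕ._* 2 ℕ.^ n) (sym (ℕ.^-*-assoc 2 2 n)))))

-- The sum at n = 0 and ζ(3)

Z : ℕ → ℚ
Z = ∑ (ζ-term 3)

ι³*ζ-term : ∀ n .{{_ : NonZero n}} → ι n * ι n * ι n * ζ-term 3 n ≡ 1ℚ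
ι³*ζ-term n = trans (cong (_* ζ-term 3 n) (sym (ι-cube n))) (trans (ι-/ 1 (n ℕ.^ 3) {{ℕ.m^n≢0 n 3}}) (ι≡# 1))

8*ζ-term-odd : ∀ k → # 8 * ζ-term 3 (suc (2 ℕ.* k)) ≡ i k * i k * i k
8*ζ-term-odd k = begin-equality
  # 2 * # 2 * # 2 * z                    ≡⟨ cong (λ t → t * t * t * z) x*i ⟨
  x * i k * (x * i k) * (x * i k) * z    ≡⟨ regroup x (i k) z ⟩
  x * x * x * z * (i k * i k * i k)      ≡⟨ trans (cong (_* (i k * i k * i k)) (ι³*ζ-term (suc (2 ℕ.* k)))) (*-identityˡ (i k * i k * i k)) ⟩
  i k * i k * i k                        ∎
  where
  x = ι (suc (2 ℕ.* k))
  z = ζ-term 3 (suc (2 ℕ.* k))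
  x*i : x * i k ≡ # 2
  x*i = trans (cong (_* i k) (trans (ι-suc (2 ℕ.* k)) (cong (_+ 1ℚ) (trans (ι-* 2 k) (cong (_* ι k) (ι≡# 2)))))) ([1+2k]*i k)
  regroup : ∀ x r z → x * r * (x * r) * (x * r) * z ≡ x * x * x * z * (r * r * r)
  regroup = solve-∀ ring

8*ζ-term-even : ∀ k → # 8 * ζ-term 3 (2 ℕ.+ 2 ℕ.* k) ≡ ζ-term 3 (suc k)
8*ζ-term-even k = begin-equality
  # 8 * z                          ≡⟨ *-identityʳ (# 8 * z) ⟨
  # 8 * z * 1ℚ                     ≡⟨ cong (# 8 * z *_) (ι³*ζ-term (suc k)) ⟨
  # 8 * z * (v * v * v * z′)       ≡⟨ regroup v z z′ ⟩
  # 2 * v * (# 2 * v) * (# 2 * v) * z * z′  ≡⟨ cong (λ t → t * t * t * z * z′) double ⟨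
  x * x * x * z * z′               ≡⟨ trans (cong (_* z′) (ι³*ζ-term (2 ℕ.+ 2 ℕ.* k))) (*-identityˡ z′) ⟩
  z′                               ∎
  where
  v = ι (suc k)
  x = ι (2 ℕ.+ 2 ℕ.* k)
  z = ζ-term 3 (2 ℕ.+ 2 ℕ.* k)
  z′ = ζ-term 3 (suc k)
  double : x ≡ # 2 * v
  double = trans (cong ι (sym (ℕ.*-suc 2 k))) (trans (ι-* 2 (suc k)) (cong (_* v) (ι≡# 2)))
  regroup : ∀ v z z′ → # 8 * z * (v * v * v * z′) ≡ # 2 * v * (# 2 * v) * (# 2 * v) * z * z′
  regroup = solve-∀ ring

-- Eight times the odd-index terms of `Z (2 * M)` make up `s 0 M`, and eight times the even-index
-- terms make up `Z M`. The limit is therefore (8 - 1) ζ(3), while the identity is exact for every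
-- M.
s-zero≡Z : ∀ M → s 0 M ≡ # 8 * Z (2 ℕ.* M) - Z M
s-zero≡Z zero    = refl
s-zero≡Z (suc M) = begin-equality
  s 0 M + i M * i M * i M
    ≡⟨ cong₂ _+_ (s-zero≡Z M) (sym (8*ζ-term-odd M)) ⟩
  # 8 * Z (2 ℕ.* M) - Z M + # 8 * a
    ≡⟨ regroup (Z (2 ℕ.* M)) (Z M) a (# 8 * b) ⟩
  # 8 * Z (2 ℕ.* M) + # 8 * a + # 8 * b - (Z M + # 8 * b)
    ≡⟨ cong₂ _-_ (collect (Z (2 ℕ.* M)) a b) (cong (_+_ (Z M)) (8*ζ-term-even M)) ⟩
  # 8 * Z (2 ℕ.+ 2 ℕ.* M) - Z (suc M)
    ≡⟨ cong (λ m → # 8 * Z m - Z (suc M)) (ℕ.*-suc 2 M) ⟨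
  # 8 * Z (2 ℕ.* suc M) - Z (suc M) ∎
  where
  a = ζ-term 3 (suc (2 ℕ.* M))
  b = ζ-term 3 (2 ℕ.+ 2 ℕ.* M)
  regroup : ∀ z z′ a c → # 8 * z - z′ + # 8 * a ≡ # 8 * z + # 8 * a + c - (z′ + c)
  regroup = solve-∀ ring
  collect : ∀ z a b → # 8 * z + # 8 * a + # 8 * b ≡ # 8 * (z + a + b)
  collect = solve-∀ ring

-- From index N on, `Z` stays within 1 of `Z N`, which costs 8 + 1 = 9 in 8 `Z (2 * M)` - `Z M`.
s-zero-bounded : ∃[ c ] ∃[ N ] (∀ M → M ℕ.≥ N → s 0 M ≤ c)
s-zero-bounded = let N , close = ζ-cauchy 3 1ℚ (positive⁻¹ 1ℚ) in # 9 + # 7 * Z N , N , λ M M≥N → begin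
  s 0 M                                              ≡⟨ s-zero≡Z M ⟩
  # 8 * Z (2 ℕ.* M) - Z M                            ≡⟨ regroup (Z (2 ℕ.* M)) (Z M) (Z N) ⟩
  # 8 * (Z (2 ℕ.* M) - Z N) + - (Z M - Z N) + # 7 * Z N
    ≤⟨ +-monoˡ-≤ (# 7 * Z N) (+-mono-≤
         (*-monoˡ (nonNegative⁻¹ (# 8)) (≤-trans (p≤∣p∣ (Z (2 ℕ.* M) - Z N)) (<⇒≤ (close (2 ℕ.* M) N (ℕ.≤-trans M≥N (ℕ.m≤m+n M _)) ℕ.≤-refl))))
         (≤-trans (p≤∣p∣ (- (Z M - Z N))) (≤-trans (≤-reflexive (∣-p∣≡∣p∣ (Z M - Z N))) (<⇒≤ (close M N M≥N ℕ.≤-refl))))) ⟩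
  # 9 + # 7 * Z N                                    ∎
  where
  regroup : ∀ a b c → # 8 * a - b ≡ # 8 * (a - c) + - (b - c) + # 7 * c
  regroup = solve-∀ ring

-- Passage to the limit

i≤2/ : ∀ k → i k ≤ # 2 * (+ 1 / suc k)
i≤2/ k = begin
  i k                        ≡⟨ trans (sym (*-identityʳ (i k))) (cong (i k *_) (sym 1+k)) ⟩
  i k * ((ι k + 1ℚ) * r)     ≡⟨ regroup (ι k) (i k) r ⟩
  ((ι k + ½) * i k + ½ * i k) * r  ≤⟨ *-monoʳ 0≤r (+-mono-≤ (≤-reflexive (y*i k)) (*-monoˡ (nonNegative⁻¹ ½) (i≤2 k))) ⟩
  # 2 * r                    ∎
  where
  r = + 1 / suc k
  0≤r : 0ℚ ≤ r
  0≤r = nonNegative⁻¹ r {{normalize-nonNeg 1 (suc k)}}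
  1+k : (ι k + 1ℚ) * r ≡ 1ℚ
  1+k = trans (cong (_* r) (sym (ι-suc k))) (trans (ι-/ 1 (suc k)) (ι≡# 1))
  regroup : ∀ k i r → i * ((k + 1ℚ) * r) ≡ ((k + ½) * i + ½ * i) * r
  regroup = solve-∀ ring

c*i-small : ∀ c ε → ε > 0ℚ → ∃[ N ] (∀ n → n ℕ.≥ N → c * i n ≤ ε)
c*i-small c ε ε>0 = let N , 1/N<δ = archimedean δ δ>0 in N , λ n n≥N → begin
  c * i n                       ≤⟨ *-monoʳ (0≤i n) (≤-trans (p≤∣p∣ c) (p≤p+q ∣ c ∣ (nonNegative⁻¹ 1ℚ))) ⟩
  c′ * i n                      ≤⟨ *-monoˡ 0≤c′ (≤-trans (i≤2/ n) (*-monoˡ (nonNegative⁻¹ (# 2))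
                                     (≤-trans (1/-anti (suc N) (suc n) (ℕ.s≤s n≥N)) (<⇒≤ 1/N<δ)))) ⟩
  c′ * (# 2 * (1/ c′ * (½ * ε)))  ≡⟨ regroup c′ (1/ c′) ε ⟩
  c′ * 1/ c′ * ε                ≡⟨ trans (cong (_* ε) (*-inverseʳ c′)) (*-identityˡ ε) ⟩
  ε                             ∎
  where
  c′ = ∣ c ∣ + 1ℚ
  instance
    c′-pos : Positive c′
    c′-pos = nonNeg+pos⇒pos ∣ c ∣ {{∣-∣-nonNeg c}} 1ℚ
    _ = pos⇒nonZero c′
    _ = 1/pos⇒pos c′
  0≤c′ : 0ℚ ≤ c′
  0≤c′ = <⇒≤ (positive⁻¹ c′)
  δ = 1/ c′ * (½ * ε)
  δ>0 : δ > 0ℚ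
  δ>0 = subst (_< δ) (*-zeroʳ (1/ c′)) (*-monoʳ-<-pos (1/ c′) (half-pos ε ε>0))
  regroup : ∀ c r ε → c * (# 2 * (r * (½ * ε))) ≡ c * r * ε
  regroup = solve-∀ ring

8/3 64/3 : ℚ
8/3 = + 8 / 3
64/3 = + 64 / 3

-- `σ-asymptotics` solved for the partial sum, with `s 0 M` = 7 `Z M` + 8 (`Z (2 * M)` - `Z M`).
-- Inverting ⅜ gives 8/3, whence 56/3 = 7 · 8/3 and 64/3 = 8 · 8/3. The first summand is small for
-- large n; the others vanish as M grows with n fixed.
partial-sum-bound : ∀ n → ∃[ K ] (∀ M → ∣ ∑ domb-term n - (+ 56 / 3) * Z M ∣ ≤
  8/3 * # 64 * s 0 M * i n + (64/3 * ∣ Z (2 ℕ.* M) - Z M ∣ + 8/3 * K * i M))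
partial-sum-bound n = let K , e≤ = O-* {1} r (σ-asymptotics n) in K , λ M → begin
  ∣ T - (+ 56 / 3) * Z M ∣
    ≡⟨ cong ∣_∣ (eq M) ⟩
  ∣ 8/3 * (r * e M) + (64/3 * Δ M - 8/3 * (r * σ n M)) ∣
    ≤⟨ ≤-trans (∣p+q∣≤∣p∣+∣q∣ (8/3 * (r * e M)) (64/3 * Δ M - 8/3 * (r * σ n M)))
         (+-monoʳ-≤ ∣ 8/3 * (r * e M) ∣ (∣p-q∣≤∣p∣+∣q∣ (64/3 * Δ M) (8/3 * (r * σ n M)))) ⟩
  ∣ 8/3 * (r * e M) ∣ + (∣ 64/3 * Δ M ∣ + ∣ 8/3 * (r * σ n M) ∣)
    ≡⟨ cong₂ _+_ (∣p*q∣≡∣p∣*∣q∣ 8/3 (r * e M)) (cong₂ _+_ (∣p*q∣≡∣p∣*∣q∣ 64/3 (Δ M)) (0≤p⇒∣p∣≡p (0≤* 0≤8/3 (0≤* 0≤r (0≤σ M))))) ⟩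
  8/3 * ∣ r * e M ∣ + (64/3 * ∣ Δ M ∣ + 8/3 * (r * σ n M))
    ≤⟨ +-mono-≤ (*-monoˡ 0≤8/3 (e≤ M)) (+-monoʳ-≤ (64/3 * ∣ Δ M ∣) (*-monoˡ 0≤8/3 (*-monoˡ 0≤r (σ-decay n M)))) ⟩
  8/3 * (K * (i M * 1ℚ)) + (64/3 * ∣ Δ M ∣ + 8/3 * (r * (# 64 * d n * s 0 M * i n)))
    ≡⟨ regroup K (i M) (64/3 * ∣ Δ M ∣) r (d n) (s 0 M) (i n) ⟩
  8/3 * # 64 * (d n * r) * s 0 M * i n + (64/3 * ∣ Δ M ∣ + 8/3 * K * i M)
    ≡⟨ cong (λ x → x * s 0 M * i n + (64/3 * ∣ Δ M ∣ + 8/3 * K * i M)) (cong (8/3 * # 64 *_) d*r) ⟩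
  8/3 * # 64 * s 0 M * i n + (64/3 * ∣ Δ M ∣ + 8/3 * K * i M) ∎
  where
  T = ∑ domb-term n
  instance
    _ = D≢0 n
  r = + 1 / D n
  d*r : d n * r ≡ 1ℚ
  d*r = trans (ι-/ 1 (D n)) (ι≡# 1)
  0≤r : 0ℚ ≤ r
  0≤r = nonNegative⁻¹ r {{normalize-nonNeg 1 (D n)}}
  0≤8/3 : 0ℚ ≤ 8/3
  0≤8/3 = nonNegative⁻¹ 8/3
  0≤σ : ∀ M → 0ℚ ≤ σ n M
  0≤σ M = 0≤* (0≤φ n) (0≤s n M)
  e Δ : ℕ → ℚ
  e M = σ n M - d n * (s 0 M - ⅜ * T)
  Δ M = Z (2 ℕ.* M) - Z M
  expand : ∀ T z z′ → T - (+ 56 / 3) * z ≡ 8/3 * (1ℚ * (⅜ * T - (# 8 * z′ - z))) + 64/3 * (z′ - z)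
  expand = solve-∀ ring
  collect : ∀ T S r d σ Δ → 8/3 * (d * r * (⅜ * T - S)) + 64/3 * Δ ≡ 8/3 * (r * (σ - d * (S - ⅜ * T))) + (64/3 * Δ - 8/3 * (r * σ))
  collect = solve-∀ ring
  eq : ∀ M → T - (+ 56 / 3) * Z M ≡ 8/3 * (r * e M) + (64/3 * Δ M - 8/3 * (r * σ n M))
  eq M = begin-equality
    T - (+ 56 / 3) * Z M
      ≡⟨ expand T (Z M) (Z (2 ℕ.* M)) ⟩
    8/3 * (1ℚ * (⅜ * T - (# 8 * Z (2 ℕ.* M) - Z M))) + 64/3 * Δ M
      ≡⟨ cong₂ (λ x y → 8/3 * (x * (⅜ * T - y)) + 64/3 * Δ M) d*r (s-zero≡Z M) ⟨
    8/3 * (d n * r * (⅜ * T - s 0 M)) + 64/3 * Δ M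
      ≡⟨ collect T (s 0 M) r (d n) (σ n M) (Δ M) ⟩
    8/3 * (r * e M) + (64/3 * Δ M - 8/3 * (r * σ n M)) ∎
  regroup : ∀ K i x r d S j → 8/3 * (K * (i * 1ℚ)) + (x + 8/3 * (r * (# 64 * d * S * j))) ≡
    8/3 * # 64 * (d * r) * S * j + (x + 8/3 * K * i)
  regroup = solve-∀ ring

theorem1p2 : HasSum domb-term ((+ 56 / 3) · ζ 3)
theorem1p2 ε ε>0 =
  let c , M₀ , s≤c = s-zero-bounded
      -- `c` and `M₀` do not depend on n, so N can be chosen from ε alone.
      N , small = c*i-small (8/3 * # 64 * c) ε ε>0
  in N , λ n n≥N δ δ>0 →
  -- `K` depends on n, but n is fixed by now; the two remaining errors take half of δ each, and 3/64
  -- cancels the factor 64/3.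
  let K , bound = partial-sum-bound n
      M₁ , small₁ = c*i-small (8/3 * K) (½ * δ) (half-pos δ δ>0)
      M₂ , close = ζ-cauchy 3 (3/64 * (½ * δ)) (3/64*-pos (half-pos δ δ>0))
  in M₀ ℕ.⊔ (M₁ ℕ.⊔ M₂) , λ M M≥ →
  let M≥M₀ = ℕ.m⊔n≤o⇒m≤o M₀ (M₁ ℕ.⊔ M₂) M≥
      M≥M₁⊔M₂ = ℕ.m⊔n≤o⇒n≤o M₀ (M₁ ℕ.⊔ M₂) M≥
      M≥M₁ = ℕ.m⊔n≤o⇒m≤o M₁ M₂ M≥M₁⊔M₂
      M≥M₂ = ℕ.m⊔n≤o⇒n≤o M₁ M₂ M≥M₁⊔M₂
      Δ = ∣ Z (2 ℕ.* M) - Z M ∣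
  in begin
    ∣ ∑ domb-term n - (+ 56 / 3) * Z M ∣
      ≤⟨ bound M ⟩
    8/3 * # 64 * s 0 M * i n + (64/3 * Δ + 8/3 * K * i M)
      ≤⟨ +-mono-≤ (≤-trans (*-monoʳ (0≤i n) (*-monoˡ (nonNegative⁻¹ (8/3 * # 64)) (s≤c M M≥M₀))) (small n n≥N))
           (+-mono-≤ (*-monoˡ (nonNegative⁻¹ 64/3) (<⇒≤ (close (2 ℕ.* M) M (ℕ.≤-trans M≥M₂ (ℕ.m≤m+n M _)) M≥M₂))) (small₁ M M≥M₁)) ⟩
    ε + (64/3 * (3/64 * (½ * δ)) + ½ * δ)
      ≡⟨ cong (_+_ ε) (collect δ) ⟩
    ε + δ ∎
  where
  3/64 : ℚ
  3/64 = + 3 / 64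
  3/64*-pos : ∀ {x} → x > 0ℚ → 3/64 * x > 0ℚ
  3/64*-pos {x} x>0 = subst (_< 3/64 * x) (*-zeroʳ 3/64) (*-monoʳ-<-pos 3/64 x>0)
  collect : ∀ δ → 64/3 * (3/64 * (½ * δ)) + ½ * δ ≡ δ
  collect = solve-∀ ring
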